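{- Let $\mathcal{H}=\{H_1,\dots,H_m\}$ be a finite nonempty family of tournaments each of which contains a tournament $H$ as a subtournament, and assume $\mathcal{H}$ has the $(\mathcal{F},v,\eta)$-strong EH-property. Then $\mathcal{H}$ has the EH-property, and hence $H$ satisfies the Erdős–Hajnal Conjecture, i.e. there is $\epsilon(H)>0$ such that every tournament $T$ not containing $H$ as a subtournament contains a transitive subtournament on at least $|T|^{\epsilon(H)}$ vertices.
   Context: Tournaments are finite; a subtournament is an induced subtournament on a subset of vertices; a tournament is transitive if it has no directed cycle. For a tournament $T$, $tr(T)$ is the maximum size of a transitive subtournament of $T$. A set $V_1$ is complete to $V_2$ if every vertex of $V_1$ has an edge to every vertex of $V_2$. For disjoint nonempty $X,Y\subseteq V(T)$, $d(X,Y)=e_{X,Y}/(|X||Y|)$ where $e_{X,Y}$ is the number of edges $(x,y)$ with $x\in X,y\in Y$. For a $\{0,1\}$-vector $v$ of length $m'$, let $\zeta^v(i)=|\{j\le i: v(j)=1\}|$. Let $\eta$ be a vector of positive integers of length $\zeta^v(m')$ and $k=|\{j:v(j)=0\}|+\sum_i \eta(i)$. For a tournament $T$, $c>0$, $0\le\lambda<1$, a $(v,\eta,c,\lambda)$-m-sequence in $T$ is a sequence $\chi=(S_1,\dots,S_{m'})$ of pairwise disjoint subsets of $V(T)$ such that: if $v(i)=1$ then $S_i$ induces a transitive subtournament and is partitioned into $\eta(\zeta^v(i))$ sets $S_{i,1},\dots,S_{i,\eta(\zeta^v(i))}$ with $S_{i,a}$ complete to $S_{i,b}$ for $a<b$ and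 $|S_{i,a}|\ge c\,tr(T)$ for all $a$; if $v(i)=0$ then $|S_i|\ge c|T|$; and $d(S_i,S_j)\ge 1-\lambda$ for all $i<j$. Its long representation $l(\chi)=(T_1,\dots,T_k)$ is obtained by replacing each $S_i$ with $v(i)=1$ by $S_{i,1},\dots,S_{i,\eta(\zeta^v(i))}$ in order; $V(\chi)=\bigcup S_i$. A $c'$-strong pair in $\chi$ is a pair $(A,B)$ of disjoint subsets of $V(\chi)$ with $|A|\ge c'|T|$, such that either $|B|\ge c'|T|$ or ($B$ induces a transitive subtournament and $|B|\ge c'\,tr(T)$), and $d(A,B)=1$ or $d(B,A)=1$. With $V(H_i)=\{h^i_1,\dots,h^i_{|H_i|}\}$ and $\mathcal{F}=\{f_1,\dots,f_m\}$, $f_i:V(H_i)\to\{1,\dots,k\}$ injective, $\mathcal{H}$ has the $(\mathcal{F},v,\eta)$-strong EH-property if for every $c_1>0$ there exist $\lambda_0>0$, $c_2>0$ such that for every tournament $T$, every $0\le\lambda\le\lambda_0$ and every $(v,\eta,c_1,\lambda)$-m-sequence $\chi$ in $T$ with $l(\chi)=(T_1,\dots,T_k)$, either there exist $i$ and vertices $x_j\in T_{f_i(h^i_j)}$ ($1\le j\le|H_i|$) such that $x_j\mapsto h^i_j$ is an isomorphism from the subtournament induced on $\{x_1,\dots,x_{|H_i|}\}$ onto $H_i$, or $\chi$ contains a $c_2$-strong pair. A finite family $\mathcal{H}$ has the EH-property if there is $\epsilon>0$ such that every tournament $T$ containing no member of $\mathcal{H}$ as a subtournament contains a transitive subtournament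 on at least $|T|^{\epsilon}$ vertices. -}

module Defs where

open import Data.Bool using (Bool; true; false; not; _∧_; if_then_else_)
open import Data.Nat using (ℕ; zero; suc; _+_; _^_; NonZero) renaming (_*_ to _*ℕ_; _≤_ to _≤ℕ_)
open import Data.Nat.Properties using (+-comm; +-assoc)
open import Data.Fin using (Fin; zero; suc; inject₁; fromℕ)
open import Data.Fin.Subset using (Subset; _∈_; _⊆_; _∩_; ∣_∣; Nonempty; Empty; ⋃)
open import Data.Vec using (Vec; []; _∷_; lookup; tabulate; toList; _++_; cast)
import Data.Vec as Vec
open import Data.List using (List; []; _∷_)
open import Data.List.Relation.Unary.AllPairs using (AllPairs)
open import Data.Vec.Relation.Unary.All using (All)
open import Data.Integer using (+_)
open import Data.Rational using (ℚ; _/_; 0ℚ; 1ℚ; _-_; _<_; _≤_) renaming (_*_ to _*ℚ_)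
open import Data.Product using (Σ; ∃; _×_; _,_)
open import Data.Sum using (_⊎_)
open import Data.Unit using (⊤)
open import Data.Empty using (⊥)
open import Relation.Nullary using (¬_)
open import Relation.Binary.PropositionalEquality using (_≡_; _≢_; sym; trans; cong)
open import Function.Definitions using (Injective)

-- Tournaments on vertex set Fin size; E x y ≡ true means the edge x → y.

record Tournament : Set where
  field
    size  : ℕ
    E     : Fin size → Fin size → Bool
    irrefl : ∀ x → E x x ≡ false
    tourn  : ∀ x y → x ≢ y → E x y ≡ not (E y x)
open Tournament public

ℕ→ℚ : ℕ → ℚ
ℕ→ℚ n = + n / 1

module _ (T : Tournament) where

  DirectedCycleIn : Subset (size T) → Set
  DirectedCycleIn S =
    Σ ℕ λ k → Σ (Fin (suc k) → Fin (size T)) λ f →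
      Injective _≡_ _≡_ f
      × (∀ i → f i ∈ S)
      × (∀ (i : Fin k) → E T (f (inject₁ i)) (f (suc i)) ≡ true)
      × (E T (f (fromℕ k)) (f zero) ≡ true)

  TransitiveSet : Subset (size T) → Set
  TransitiveSet S = ¬ DirectedCycleIn S

  IsTr : ℕ → Set
  IsTr t = (Σ (Subset (size T)) λ S → TransitiveSet S × ∣ S ∣ ≡ t)
         × (∀ S → TransitiveSet S → ∣ S ∣ ≤ℕ t)

  CompleteTo : Subset (size T) → Subset (size T) → Set
  CompleteTo A B = ∀ a b → a ∈ A → b ∈ B → E T a b ≡ true

  edges : Subset (size T) → Subset (size T) → ℕ
  edges X Y = Vec.sum (tabulate λ x → Vec.sum (tabulate λ y →
                 if lookup X x ∧ lookup Y y ∧ E T x y then 1 else 0))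

  -- d(X,Y) ≥ q, for disjoint nonempty X, Y  (d(X,Y) = e_{X,Y}/(|X||Y|),
  -- denominators cleared)
  DensityAtLeast : ℚ → Subset (size T) → Subset (size T) → Set
  DensityAtLeast q X Y = Nonempty X × Nonempty Y
    × (q *ℚ ℕ→ℚ (∣ X ∣ *ℕ ∣ Y ∣) ≤ ℕ→ℚ (edges X Y))

  DensityOne : Subset (size T) → Subset (size T) → Set
  DensityOne X Y = Nonempty X × Nonempty Y × (edges X Y ≡ ∣ X ∣ *ℕ ∣ Y ∣)

Disjoint : ∀ {n} → Subset n → Subset n → Set
Disjoint A B = Empty (A ∩ B)

IsEmbedding : (H T : Tournament) → (Fin (size H) → Fin (size T)) → Set
IsEmbedding H T x = Injective _≡_ _≡_ x × (∀ a b → E T (x a) (x b) ≡ E H a b)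

Contains : Tournament → Tournament → Set
Contains T H = Σ (Fin (size H) → Fin (size T)) λ x → IsEmbedding H T x

ones : List Bool → ℕ
ones [] = 0
ones (true ∷ v) = suc (ones v)
ones (false ∷ v) = ones v

zeros : List Bool → ℕ
zeros [] = 0
zeros (true ∷ v) = zeros v
zeros (false ∷ v) = suc (zeros v)

kOf : (v : List Bool) → Vec ℕ (ones v) → ℕ
kOf v η = zeros v + Vec.sum η

-- Candidate sequences (S_1,…,S_m') shaped by (v, η): a block with v(i)=0 is
-- a single set S_i; a block with v(i)=1 is given by its parts
-- S_{i,1},…,S_{i,η(ζ^v(i))}, and S_i is their union.
data Seq (n : ℕ) : (v : List Bool) → Vec ℕ (ones v) → Set where
  []  : Seq n [] []
  big : ∀ {v η} → Subset n → Seq n v η → Seq n (false ∷ v) η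
  trs : ∀ {v η p} → Vec (Subset n) p → Seq n v η → Seq n (true ∷ v) (p ∷ η)

blocks : ∀ {n v η} → Seq n v η → List (Subset n)
blocks [] = []
blocks (big S χ) = S ∷ blocks χ
blocks (trs ps χ) = ⋃ (toList ps) ∷ blocks χ

Vχ : ∀ {n v η} → Seq n v η → Subset n
Vχ χ = ⋃ (blocks χ)

private
  kLemma : ∀ p a b → p + (a + b) ≡ a + (p + b)
  kLemma p a b = trans (sym (+-assoc p a b))
                   (trans (cong (_+ b) (+-comm p a)) (+-assoc a p b))

long : ∀ {n v η} → Seq n v η → Vec (Subset n) (kOf v η)
long [] = []
long (big S χ) = S ∷ long χ
long {v = true ∷ v} {η = p ∷ η} (trs ps χ) =
  cast (kLemma p (zeros v) (Vec.sum η)) (ps ++ long χ)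

module _ (T : Tournament) (t : ℕ) (c λ' : ℚ) where

  -- per-block conditions of an m-sequence (t = tr(T))
  BlocksOK : ∀ {v η} → Seq (size T) v η → Set
  BlocksOK [] = ⊤
  BlocksOK (big S χ) = (c *ℚ ℕ→ℚ (size T) ≤ ℕ→ℚ ∣ S ∣) × BlocksOK χ
  BlocksOK (trs ps χ) =
      TransitiveSet T (⋃ (toList ps))
    × AllPairs Disjoint (toList ps)
    × AllPairs (CompleteTo T) (toList ps)
    × All (λ P → c *ℚ ℕ→ℚ t ≤ ℕ→ℚ ∣ P ∣) ps
    × BlocksOK χ

  -- χ is a (v,η,c,λ)-m-sequence in T  (assuming IsTr T t)
  IsMSeq : ∀ {v η} → Seq (size T) v η → Set
  IsMSeq χ = (0ℚ < c) × (0ℚ ≤ λ') × (λ' < 1ℚ)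
    × AllPairs Disjoint (blocks χ)
    × BlocksOK χ
    × AllPairs (DensityAtLeast T (1ℚ - λ')) (blocks χ)

-- χ contains a c'-strong pair (t = tr(T))
StrongPair : (T : Tournament) (t : ℕ) (c' : ℚ) → ∀ {v η} → Seq (size T) v η → Set
StrongPair T t c' χ = Σ (Subset (size T)) λ A → Σ (Subset (size T)) λ B →
    Disjoint A B × A ⊆ Vχ χ × B ⊆ Vχ χ
  × (c' *ℚ ℕ→ℚ (size T) ≤ ℕ→ℚ ∣ A ∣)
  × ((c' *ℚ ℕ→ℚ (size T) ≤ ℕ→ℚ ∣ B ∣)
     ⊎ (TransitiveSet T B × (c' *ℚ ℕ→ℚ t ≤ ℕ→ℚ ∣ B ∣)))
  × (DensityOne T A B ⊎ DensityOne T B A)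

StrongEH : {m : ℕ} (Hs : Fin m → Tournament) (v : List Bool) (η : Vec ℕ (ones v))
         → ((i : Fin m) → Fin (size (Hs i)) → Fin (kOf v η)) → Set
StrongEH {m} Hs v η Fs =
  ∀ (c₁ : ℚ) → 0ℚ < c₁ →
  Σ ℚ λ λ₀ → Σ ℚ λ c₂ → (0ℚ < λ₀) × (0ℚ < c₂) ×
    (∀ (T : Tournament) (t : ℕ) → IsTr T t →
     ∀ (λ' : ℚ) → 0ℚ ≤ λ' → λ' ≤ λ₀ →
     ∀ (χ : Seq (size T) v η) → IsMSeq T t c₁ λ' χ →
       (Σ (Fin m) λ i → Σ (Fin (size (Hs i)) → Fin (size T)) λ x →
          (∀ j → x j ∈ lookup (long χ) (Fs i j)) × IsEmbedding (Hs i) T x)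
       ⊎ StrongPair T t c₂ χ)

-- |S| ≥ |T|^(p/q), i.e. |S|^q ≥ |T|^p
AtLeastPow : ℕ → ℕ → ℕ → ℕ → Set
AtLeastPow s N p q = N ^ p ≤ℕ s ^ q

-- EH-property of the family ℋ, with ε = p/q > 0
EHProperty : {m : ℕ} → (Fin m → Tournament) → Set
EHProperty {m} Hs = Σ ℕ λ p → Σ ℕ λ q → NonZero p × NonZero q ×
  (∀ (T : Tournament) → (∀ i → ¬ Contains T (Hs i)) →
     Σ (Subset (size T)) λ S → TransitiveSet T S × AtLeastPow ∣ S ∣ (size T) p q)

-- H satisfies the Erdős–Hajnal conjecture, with ε(H) = p/q > 0
ErdosHajnal : Tournament → Set
ErdosHajnal H = Σ ℕ λ p → Σ ℕ λ q → NonZero p × NonZero q ×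
  (∀ (T : Tournament) → ¬ Contains T H →
     Σ (Subset (size T)) λ S → TransitiveSet T S × AtLeastPow ∣ S ∣ (size T) p q)

{-# OPTIONS --safe #-}
module Submission where

-- Suppose T contains no member of ℋ, every smaller such tournament satisfies the bound |T| ≤ tr(T)^q,
-- and tr(T)^q < |T|.  Embedding a member of ℋ greedily fails, so every large vertex set contains two
-- large sets A, B with few edges in one direction; iterating inside A, and taking transitive sets
-- inside the sets B, gives an m-sequence with arbitrarily small λ.  A strong pair in it is impossible
-- for large q: adding up transitive sets in its two parts, each of size more than (1 - c) tr(T) or
-- tr(T) / 2 by minimality, would exceed tr(T).

open import Defs
open import Data.Bool using (Bool; true; false; _∧_; if_then_else_; not)
import Data.Bool.Properties as 𝔹ₚ
open import Data.Empty using (⊥; ⊥-elim)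
open import Data.Fin using (Fin; zero; suc; inject₁; fromℕ)
import Data.Fin as Fin
import Data.Fin.Properties as Finₚ
open import Data.Fin.Subset as Subset using (Subset; ∣_∣; ⋃)
import Data.Fin.Subset.Properties as Subsetₚ
import Data.Integer as ℤ
import Data.Integer.Properties as ℤₚ
open import Data.List using (List; []; _∷_; _++_; length; filter; take; drop; map; concat; lookup; allFin)
open import Data.List.Membership.Propositional using (_∈_; _∉_; find)
import Data.List.Membership.Propositional.Properties as ∈ₚ
import Data.List.Properties as Listₚ
open import Data.List.Relation.Binary.Subset.Propositional using (_⊆_)
open import Data.List.Relation.Unary.All as Allᴸ using ([]; _∷_) renaming (All to Allᴸ)
import Data.List.Relation.Unary.All.Properties as Allₚ
open import Data.List.Relation.Unary.AllPairs as AllPairs using (AllPairs; []; _∷_)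
import Data.List.Relation.Unary.AllPairs.Properties as AllPairsₚ
open import Data.List.Relation.Unary.Any as Any using (here; there)
import Data.List.Relation.Unary.Any.Properties as Anyₚ
open import Data.List.Relation.Unary.Unique.Propositional using (Unique)
import Data.List.Relation.Unary.Unique.Propositional.Properties as Uniqueₚ
open import Data.Nat
  using (ℕ; zero; suc; _+_; _*_; _^_; _≤_; _<_; s≤s; z≤n; _≤?_; _/_; _%_; NonZero; >-nonZero)
open import Data.Nat.Coprimality using (1-coprimeTo) renaming (sym to coprime-sym)
import Data.Nat.DivMod as DivModₚ
open import Data.Nat.Induction using (<-wellFounded)
import Data.Nat.Properties as ℕₚ
open import Data.Nat.Solver using (module +-*-Solver)
open import Data.Product using (Σ; ∃; _×_; _,_; proj₁; proj₂)
open import Data.Rational using (ℚ; mkℚ; 0ℚ; 1ℚ; *≤*; *<*; toℚᵘ; _-_)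
import Data.Rational as ℚ
import Data.Rational.Properties as ℚₚ
import Data.Rational.Unnormalised as ℚᵘ
import Data.Rational.Unnormalised.Properties as ℚᵘₚ
open import Data.Sum using (_⊎_; inj₁; inj₂)
open import Data.Unit using (tt)
open import Data.Vec as Vec using (Vec; []; _∷_; tabulate)
import Data.Vec.Properties as Vecₚ
open import Data.Vec.Relation.Unary.All using (All; []; _∷_)
open import Function using (_∘_; flip)
open import Function.Definitions using (Injective)
open import Induction.WellFounded using (Acc; acc)
open import Relation.Binary.Definitions using (tri<; tri≈; tri>)
open import Relation.Binary.PropositionalEquality
open import Relation.Nullary using (¬_; Dec; ¬?; yes; no; contradiction)
open import Relation.Nullary.Decidable using (_→-dec_; _×-dec_; map′)
open import Relation.Unary using (Decidable) renaming (_⊆_ to _⊆ₚ_)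

-- Reciprocals in ℚ

-- The delicate case is a strong pair whose second part is only a transitive set of size `c tr(T)`:
-- half of `tr(T)` inside the first part is then too little, and more than `(1 - c) tr(T)` is
-- needed. A set of `c |T|` vertices supplies this once `(1 - c)^q ≤ c`, which `q ≥ σ²` ensures for
-- `c = 1/(σ + 1)`. The exponent is therefore fixed last: `c₁` depends on `v` and `η` alone, `λ₀`
-- and `c₂` come from `c₁`, the block size from `λ₀`, then `σ` from the block size and `c₂`, and
-- finally `q`, with `ε = 1/q`. No separate treatment of small tournaments arises, because
-- `tr(T) ≥ 2` and `tr(T)^q < |T|` force `|T| > 2^q`, and `2^q` is chosen above all thresholds.
-- Every proportion is replaced by a reciprocal `unit k`, that is `1/(k + 1)`, so that all estimates
-- take place in ℕ.

unit : ℕ → ℚ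
unit k = mkℚ (ℤ.+ 1) k (1-coprimeTo (suc k))

ℕ→ℚ-mk : ∀ n → ℕ→ℚ n ≡ mkℚ (ℤ.+ n) 0 (coprime-sym (1-coprimeTo n))
ℕ→ℚ-mk n = ℚₚ.↥p/↧p≡p (mkℚ (ℤ.+ n) 0 (coprime-sym (1-coprimeTo n)))

toℚᵘ-ℕ→ℚ : ∀ n → toℚᵘ (ℕ→ℚ n) ≡ ℚᵘ.mkℚᵘ (ℤ.+ n) 0
toℚᵘ-ℕ→ℚ n = cong toℚᵘ (ℕ→ℚ-mk n)

unit>0 : ∀ k → 0ℚ ℚ.< unit k
unit>0 k = *<* (ℤ.+<+ (s≤s z≤n))

unit<1 : ∀ k → unit (suc k) ℚ.< 1ℚ
unit<1 k = *<* (ℤ.+<+ (s≤s (s≤s z≤n)))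

unit-below : ∀ c → 0ℚ ℚ.< c → Σ ℕ λ k → ∀ k′ → k ≤ k′ → unit k′ ℚ.≤ c
unit-below (mkℚ (ℤ.+ zero) d _) (*<* (ℤ.+<+ ()))
unit-below (mkℚ (ℤ.+ suc p) d _) _ = d , λ k′ d≤k′ → *≤* (ℤ.+≤+
  (ℕₚ.*-mono-≤ (s≤s (z≤n {p})) (s≤s d≤k′)))

toℚᵘ-unit-* : ∀ k n → toℚᵘ (unit k ℚ.* ℕ→ℚ n) ℚᵘ.≃ ℚᵘ.mkℚᵘ (ℤ.+ n) k
toℚᵘ-unit-* k n = ℚᵘₚ.≃-trans (ℚₚ.toℚᵘ-homo-* (unit k) (ℕ→ℚ n))
  (ℚᵘₚ.≃-trans (ℚᵘₚ.≃-reflexive (cong (ℚᵘ.mkℚᵘ (ℤ.+ 1) k ℚᵘ.*_) (toℚᵘ-ℕ→ℚ n)))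
    (ℚᵘ.*≡* (trans (cong (ℤ._* ℤ.+ suc k) (ℤₚ.*-identityˡ (ℤ.+ n)))
              (cong (λ z → ℤ.+ n ℤ.* ℤ.+ z) (sym (ℕₚ.*-identityʳ (suc k)))))))

unit-≤⁺ : ∀ k {n m} → n ≤ suc k * m → unit k ℚ.* ℕ→ℚ n ℚ.≤ ℕ→ℚ m
unit-≤⁺ k {n} {m} h = ℚₚ.toℚᵘ-cancel-≤ (ℚᵘₚ.≤-respˡ-≃ (ℚᵘₚ.≃-sym (toℚᵘ-unit-* k n))
  (subst (ℚᵘ.mkℚᵘ (ℤ.+ n) k ℚᵘ.≤_) (sym (toℚᵘ-ℕ→ℚ m))
    (ℚᵘ.*≤* (subst₂ ℤ._≤_ (sym (ℤₚ.*-identityʳ (ℤ.+ n))) (ℤₚ.pos-* m (suc k))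
      (ℤ.+≤+ (subst (n ≤_) (ℕₚ.*-comm (suc k) m) h))))))

unit-≤⁻ : ∀ k {n m} → unit k ℚ.* ℕ→ℚ n ℚ.≤ ℕ→ℚ m → n ≤ suc k * m
unit-≤⁻ k {n} {m} h with subst (ℚᵘ.mkℚᵘ (ℤ.+ n) k ℚᵘ.≤_) (toℚᵘ-ℕ→ℚ m)
    (ℚᵘₚ.≤-respˡ-≃ (toℚᵘ-unit-* k n) (ℚₚ.toℚᵘ-mono-≤ h))
... | ℚᵘ.*≤* e = subst (n ≤_) (ℕₚ.*-comm m (suc k)) (ℤₚ.drop‿+≤+
      (subst₂ ℤ._≤_ (ℤₚ.*-identityʳ (ℤ.+ n)) (sym (ℤₚ.pos-* m (suc k))) e))

≤⇒≤-unit : ∀ k {c n m} → unit k ℚ.≤ c → c ℚ.* ℕ→ℚ n ℚ.≤ ℕ→ℚ m → n ≤ suc k * m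
≤⇒≤-unit k {c} {n} u≤c h = unit-≤⁻ k (ℚₚ.≤-trans
  (ℚₚ.*-monoʳ-≤-nonNeg (ℕ→ℚ n) {{nn}} u≤c) h)
  where
  nn : ℚ.NonNegative (ℕ→ℚ n)
  nn = subst ℚ.NonNegative (sym (ℕ→ℚ-mk n)) _

-- Multiplying the claim by the denominator k + 1 turns it into k a ≤ (k + 1) e.
density-≤ : ∀ k {a e} → k * a ≤ suc k * e → (1ℚ ℚ.- unit k) ℚ.* ℕ→ℚ a ℚ.≤ ℕ→ℚ e
density-≤ k {a} {e} h = ℚₚ.toℚᵘ-cancel-≤ (ℚᵘₚ.≤-respˡ-≃ (ℚᵘₚ.≃-sym eq)
  (subst (ℚᵘ.mkℚᵘ (ℤ.+ (k * a)) k ℚᵘ.≤_) (sym (toℚᵘ-ℕ→ℚ e))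
    (ℚᵘ.*≤* (subst₂ ℤ._≤_ (sym (ℤₚ.*-identityʳ (ℤ.+ (k * a)))) (ℤₚ.pos-* e (suc k))
      (ℤ.+≤+ (subst (k * a ≤_) (ℕₚ.*-comm (suc k) e) h))))))
  where
  one-minus : toℚᵘ (1ℚ ℚ.- unit k) ℚᵘ.≃ ℚᵘ.mkℚᵘ (ℤ.+ k) k
  one-minus = ℚᵘₚ.≃-trans (ℚₚ.toℚᵘ-homo-+ 1ℚ (ℚ.- unit k))
    (ℚᵘ.*≡* (trans (cong (λ z → z ℤ.* (ℤ.+ suc k)) num) (cong (λ z → ℤ.+ k ℤ.* ℤ.+ suc z) (sym (ℕₚ.+-identityʳ k)))))
    where
    num : (ℤ.+ 1) ℤ.* (ℤ.+ suc k) ℤ.+ (ℤ.- (ℤ.+ 1)) ℤ.* (ℤ.+ 1) ≡ ℤ.+ k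
    num = cong (λ z → ℤ.+ z ℤ.+ ℤ.- (ℤ.+ 1)) (ℕₚ.+-identityʳ (suc k))
  eq : toℚᵘ ((1ℚ ℚ.- unit k) ℚ.* ℕ→ℚ a) ℚᵘ.≃ ℚᵘ.mkℚᵘ (ℤ.+ (k * a)) k
  eq = ℚᵘₚ.≃-trans (ℚₚ.toℚᵘ-homo-* (1ℚ ℚ.- unit k) (ℕ→ℚ a))
    (ℚᵘₚ.≃-trans (ℚᵘₚ.*-cong {u = toℚᵘ (ℕ→ℚ a)} one-minus (ℚᵘₚ.≃-reflexive (toℚᵘ-ℕ→ℚ a)))
    (ℚᵘ.*≡* (trans (cong (ℤ._* ℤ.+ suc k) (sym (ℤₚ.pos-* k a)))
      (cong (λ z → ℤ.+ (k * a) ℤ.* ℤ.+ z) (sym (ℕₚ.*-identityʳ (suc k)))))))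

-- Counting in lists

b2n : Bool → ℕ
b2n b = if b then 1 else 0

module _ {A : Set} where

  ∑ : (A → ℕ) → List A → ℕ
  ∑ f [] = 0
  ∑ f (x ∷ xs) = f x + ∑ f xs

  count : (A → Bool) → List A → ℕ
  count p = ∑ (b2n ∘ p)

  ∑-mono : ∀ {f g} xs → (∀ {x} → x ∈ xs → f x ≤ g x) → ∑ f xs ≤ ∑ g xs
  ∑-mono [] h = z≤n
  ∑-mono (x ∷ xs) h = ℕₚ.+-mono-≤ (h (here refl)) (∑-mono xs (h ∘ there))

  ∑-cong : ∀ {f g} xs → (∀ {x} → x ∈ xs → f x ≡ g x) → ∑ f xs ≡ ∑ g xs
  ∑-cong [] h = refl
  ∑-cong (x ∷ xs) h = cong₂ _+_ (h (here refl)) (∑-cong xs (h ∘ there))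

  ∑-const : ∀ c xs → ∑ (λ _ → c) xs ≡ length xs * c
  ∑-const c [] = refl
  ∑-const c (x ∷ xs) = cong (c +_) (∑-const c xs)

  ∑-* : ∀ c f xs → ∑ (λ x → c * f x) xs ≡ c * ∑ f xs
  ∑-* c f [] = sym (ℕₚ.*-zeroʳ c)
  ∑-* c f (x ∷ xs) = trans (cong (c * f x +_) (∑-* c f xs)) (sym (ℕₚ.*-distribˡ-+ c (f x) _))

  ∑-+ : ∀ f g xs → ∑ (λ x → f x + g x) xs ≡ ∑ f xs + ∑ g xs
  ∑-+ f g [] = refl
  ∑-+ f g (x ∷ xs) = trans (cong (f x + g x +_) (∑-+ f g xs))
    (solve 4 (λ a b c d → a :+ b :+ (c :+ d) := a :+ c :+ (b :+ d)) refl (f x) (g x) (∑ f xs) (∑ g xs))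
    where open +-*-Solver

  count-filter : ∀ (p : A → Bool) xs → count p xs ≡ length (filter (λ x → p x 𝔹ₚ.≟ true) xs)
  count-filter p [] = refl
  count-filter p (x ∷ xs) with p x
  ... | true = cong suc (count-filter p xs)
  ... | false = count-filter p xs

  -- Each entry outside `P` contributes at least `c` to the sum; the additive form avoids
  -- subtraction.
  ∑-filter-≥ : ∀ {P : A → Set} (P? : Decidable P) {f : A → ℕ} c → (∀ {x} → ¬ P x → c ≤ f x) →
    ∀ xs → c * length xs ≤ ∑ f xs + c * length (filter P? xs)
  ∑-filter-≥ P? c h [] = ℕₚ.≤-refl
  ∑-filter-≥ P? {f} c h (x ∷ xs) with P? x
  ... | yes _ = begin
    c * suc (length xs) ≡⟨ ℕₚ.*-suc c _ ⟩
    c + c * length xs ≤⟨ ℕₚ.+-monoʳ-≤ c (∑-filter-≥ P? c h xs) ⟩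
    c + (∑ f xs + c * l) ≤⟨ ℕₚ.m≤n+m _ (f x) ⟩
    f x + (c + (∑ f xs + c * l)) ≡⟨ solve 4 (λ a b s l → a :+ (b :+ (s :+ b :* l)) := a :+ s :+ b :* (con 1 :+ l)) refl (f x) c (∑ f xs) l ⟩
    f x + ∑ f xs + c * suc l ∎
    where
    open ℕₚ.≤-Reasoning
    open +-*-Solver
    l = length (filter P? xs)
  ... | no ¬p = begin
    c * suc (length xs) ≡⟨ ℕₚ.*-suc c _ ⟩
    c + c * length xs ≤⟨ ℕₚ.+-mono-≤ (h ¬p) (∑-filter-≥ P? c h xs) ⟩
    f x + (∑ f xs + c * l) ≡⟨ ℕₚ.+-assoc (f x) _ _ ⟨
    f x + ∑ f xs + c * l ∎
    where
    open ℕₚ.≤-Reasoning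
    l = length (filter P? xs)

  -- Markov's inequality. Over ℕ an entry outside the filter has value at least `suc c`, and this is
  -- the factor that is cancelled.
  markov : ∀ (f : A → ℕ) c xs → 2 * ∑ f xs ≤ length xs * c →
           length xs ≤ 2 * length (filter (λ x → f x ≤? c) xs)
  markov f c xs h = ℕₚ.*-cancelˡ-≤ (suc c) (ℕₚ.+-cancelˡ-≤ (suc c * length xs) _ _ (begin
      suc c * length xs + suc c * length xs ≡⟨ cong (suc c * length xs +_) (ℕₚ.+-identityʳ _) ⟨
      2 * (suc c * length xs)               ≤⟨ ℕₚ.*-monoʳ-≤ 2 (∑-filter-≥ (λ x → f x ≤? c) (suc c) ℕₚ.≰⇒> xs) ⟩
      2 * (∑ f xs + suc c * g)              ≡⟨ ℕₚ.*-distribˡ-+ 2 (∑ f xs) _ ⟩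
      2 * ∑ f xs + 2 * (suc c * g)          ≤⟨ ℕₚ.+-monoˡ-≤ (2 * (suc c * g)) h ⟩
      length xs * c + 2 * (suc c * g)       ≤⟨ ℕₚ.+-monoˡ-≤ (2 * (suc c * g)) (ℕₚ.*-monoʳ-≤ (length xs) (ℕₚ.n≤1+n c)) ⟩
      length xs * suc c + 2 * (suc c * g)   ≡⟨ solve 3 (λ l c g → l :* c :+ con 2 :* (c :* g) := c :* l :+ c :* (con 2 :* g)) refl (length xs) (suc c) g ⟩
      suc c * length xs + suc c * (2 * g)   ∎))
    where
    open ℕₚ.≤-Reasoning
    open +-*-Solver
    g = length (filter (λ x → f x ≤? c) xs)

  length-filter-compl : ∀ {P : A → Set} (P? : Decidable P) xs →
    length (filter P? xs) + length (filter (λ x → ¬? (P? x)) xs) ≡ length xs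
  length-filter-compl P? [] = refl
  length-filter-compl P? (x ∷ xs) with P? x
  ... | yes _ = cong suc (length-filter-compl P? xs)
  ... | no _ = trans (ℕₚ.+-suc _ _) (cong suc (length-filter-compl P? xs))

  pigeonhole : ∀ k {P : Fin k → A → Set} (P? : ∀ j → Decidable (P j)) c xs →
    (∀ {x} → x ∈ xs → ∃ λ j → P j x) → 1 ≤ length xs → k * c ≤ length xs →
    ∃ λ j → c ≤ length (filter (P? j) xs)
  pigeonhole zero P? c (x ∷ xs) h _ _ with h (here refl)
  ... | () , _
  pigeonhole (suc k) P? c xs h 1≤ kc≤ with c ≤? length (filter (P? zero) xs)
  ... | yes c≤ = zero , c≤
  ... | no c≰ with pigeonhole k (P? ∘ suc) c rest h′ (ℕₚ.≤-trans (s≤s z≤n) lt) (ℕₚ.<⇒≤ lt)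
    where
    rest = filter (λ x → ¬? (P? zero x)) xs
    -- Removing a class of fewer than `c` entries leaves strictly more than `k * c`; strictness also
    -- keeps the remainder nonempty, which excludes running out of classes.
    lt : k * c < length rest
    lt = ℕₚ.+-cancelˡ-< (length (filter (P? zero) xs)) _ _ (ℕₚ.<-≤-trans
      (ℕₚ.+-monoˡ-< (k * c) (ℕₚ.≰⇒> c≰))
      (subst (c + k * c ≤_) (sym (length-filter-compl (P? zero) xs)) kc≤))
    h′ : ∀ {x} → x ∈ rest → ∃ λ j → _
    h′ x∈ with ∈ₚ.∈-filter⁻ (λ x → ¬? (P? zero x)) {xs = xs} x∈
    ... | x∈xs , ¬p with h x∈xs
    ... | zero , p = contradiction p ¬p
    ... | suc j , p = j , p
  ... | j , c≤ = suc j , ℕₚ.≤-trans c≤ (filter-filter-≤ xs)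
    where
    filter-filter-≤ : ∀ xs → length (filter (P? (suc j)) (filter (λ x → ¬? (P? zero x)) xs))
                       ≤ length (filter (P? (suc j)) xs)
    filter-filter-≤ [] = z≤n
    filter-filter-≤ (x ∷ xs) with P? zero x
    filter-filter-≤ (x ∷ xs) | yes _ with P? (suc j) x
    ... | yes _ = ℕₚ.m≤n⇒m≤1+n (filter-filter-≤ xs)
    ... | no _ = filter-filter-≤ xs
    filter-filter-≤ (x ∷ xs) | no _ with P? (suc j) x
    ... | yes _ = s≤s (filter-filter-≤ xs)
    ... | no _ = filter-filter-≤ xs

  take-⊆ : ∀ n (xs : List A) → take n xs ⊆ xs
  take-⊆ n xs x∈ = subst (_ ∈_) (Listₚ.take++drop≡id n xs) (∈ₚ.∈-++⁺ˡ x∈)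

  drop-⊆ : ∀ n (xs : List A) → drop n xs ⊆ xs
  drop-⊆ n xs x∈ = subst (_ ∈_) (Listₚ.take++drop≡id n xs) (∈ₚ.∈-++⁺ʳ (take n xs) x∈)

  filter-⊆ : ∀ {P : A → Set} (P? : Decidable P) (xs : List A) → filter P? xs ⊆ xs
  filter-⊆ P? xs = proj₁ ∘ ∈ₚ.∈-filter⁻ P?

  length-take-≤ : ∀ {n} {xs : List A} → n ≤ length xs → length (take n xs) ≡ n
  length-take-≤ {n} {xs} h = trans (Listₚ.length-take n xs) (ℕₚ.m≤n⇒m⊓n≡m h)

  AllPairs-++⁻ : ∀ {R : A → A → Set} xs {ys} → AllPairs R (xs ++ ys) →
    AllPairs R xs × AllPairs R ys × (∀ {x y} → x ∈ xs → y ∈ ys → R x y)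
  AllPairs-++⁻ [] ps = [] , ps , λ ()
  AllPairs-++⁻ {R} (x ∷ xs) {ys} (p ∷ ps) with AllPairs-++⁻ xs ps
  ... | ps₁ , ps₂ , h = Allₚ.++⁻ˡ xs p ∷ ps₁ , ps₂ , h′
    where
    h′ : ∀ {a b} → a ∈ x ∷ xs → b ∈ ys → R a b
    h′ (here refl) b∈ = Allᴸ.lookup (Allₚ.++⁻ʳ xs p) b∈
    h′ (there a∈) b∈ = h a∈ b∈

  Apart : List A → List A → Set
  Apart xs ys = ∀ {x} → x ∈ xs → x ∈ ys → ⊥

  take-drop-apart : ∀ n {xs : List A} → Unique xs → Apart (take n xs) (drop n xs)
  take-drop-apart n {xs} u x∈ y∈ with AllPairs-++⁻ (take n xs) (subst Unique (sym (Listₚ.take++drop≡id n xs)) u)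
  ... | _ , _ , h = h x∈ y∈ refl

∑-swap : ∀ {A B : Set} (g : A → B → ℕ) xs ys →
  ∑ (λ x → ∑ (g x) ys) xs ≡ ∑ (λ y → ∑ (λ x → g x y) xs) ys
∑-swap g [] ys = sym (trans (∑-const 0 ys) (ℕₚ.*-zeroʳ (length ys)))
∑-swap g (x ∷ xs) ys = trans (cong (∑ (g x) ys +_) (∑-swap g xs ys)) (sym (∑-+ (g x) _ ys))

∑-map : ∀ {A B : Set} (f : B → ℕ) (g : A → B) xs → ∑ f (map g xs) ≡ ∑ (f ∘ g) xs
∑-map f g [] = refl
∑-map f g (x ∷ xs) = cong (f (g x) +_) (∑-map f g xs)

module _ {A : Set} where

  sparse-at? : ∀ (R : A → A → Bool) s (ys : List A) → Decidable (λ x → s * count (R x) ys ≤ length ys)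
  sparse-at? R s ys x = s * count (R x) ys ≤? length ys

  -- Counting the pairs in `R` from both sides turns a bound for every `y` into an average bound
  -- over `xs`; Markov's inequality then costs the factor 2.
  halve : ∀ (R : A → A → Bool) s xs ys →
    (∀ {y} → y ∈ ys → 2 * s * count (λ x → R x y) xs ≤ length xs) →
    length xs ≤ 2 * length (filter (sparse-at? R s ys) xs)
  halve R s xs ys h = markov (λ x → s * count (R x) ys) (length ys) xs (begin
    2 * ∑ (λ x → s * count (R x) ys) xs ≡⟨ cong (2 *_) (∑-* s _ xs) ⟩
    2 * (s * ∑ (λ x → count (R x) ys) xs) ≡⟨ ℕₚ.*-assoc 2 s _ ⟨
    2 * s * ∑ (λ x → count (R x) ys) xs ≡⟨ cong (2 * s *_) (∑-swap (λ x y → b2n (R x y)) xs ys) ⟩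
    2 * s * ∑ (λ y → count (λ x → R x y) xs) ys ≡⟨ ∑-* (2 * s) _ ys ⟨
    ∑ (λ y → 2 * s * count (λ x → R x y) xs) ys ≤⟨ ∑-mono ys h ⟩
    ∑ (λ _ → length xs) ys ≡⟨ ∑-const (length xs) ys ⟩
    length ys * length xs ≡⟨ ℕₚ.*-comm (length ys) _ ⟩
    length xs * length ys ∎)
    where open ℕₚ.≤-Reasoning

  segments : ∀ k s (xs : List A) → Unique xs → k * s ≤ length xs →
    Σ (Fin k → List A) λ V → (∀ i → s ≤ length (V i)) × (∀ i → V i ⊆ xs) ×
      (∀ i → Unique (V i)) × (∀ {i j} → i ≢ j → Apart (V i) (V j))
  segments zero s xs u h = (λ ()) , (λ ()) , (λ ()) , (λ ()) , λ { {()} }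
  segments (suc k) s xs u h with segments k s (drop s xs) (Uniqueₚ.drop⁺ s u)
    (subst (k * s ≤_) (sym (Listₚ.length-drop s xs)) (ℕₚ.m+n≤o⇒m≤o∸n (k * s) (subst (_≤ length xs) (ℕₚ.+-comm s (k * s)) h)))
  ... | V , large , sub , uniq , apart = V′ , large′ , sub′ , uniq′ , apart′
    where
    V′ : Fin (suc k) → List A
    V′ zero = take s xs
    V′ (suc i) = V i
    large′ : ∀ i → s ≤ length (V′ i)
    large′ zero = ℕₚ.≤-reflexive (sym (length-take-≤ (ℕₚ.m+n≤o⇒m≤o s h)))
    large′ (suc i) = large i
    sub′ : ∀ i → V′ i ⊆ xs
    sub′ zero = take-⊆ s xs
    sub′ (suc i) = drop-⊆ s xs ∘ sub i
    uniq′ : ∀ i → Unique (V′ i)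
    uniq′ zero = Uniqueₚ.take⁺ s u
    uniq′ (suc i) = uniq i
    apart′ : ∀ {i j} → i ≢ j → Apart (V′ i) (V′ j)
    apart′ {zero} {zero} ne = ⊥-elim (ne refl)
    apart′ {zero} {suc j} ne x∈ y∈ = take-drop-apart s u x∈ (sub j y∈)
    apart′ {suc i} {zero} ne x∈ y∈ = take-drop-apart s u y∈ (sub i x∈)
    apart′ {suc i} {suc j} ne = apart (ne ∘ cong suc)

-- Sparse pairs and sequences of blocks

-- In the factor `r + k`, the summand `r` pays for shrinking each candidate set to the neighbours of
-- the vertex just embedded, and `k` for the pigeonhole among the `k` remaining sets.
embedFactor : ℕ → ℕ → ℕ
embedFactor r zero = 1
embedFactor r (suc k) = (r + k) * embedFactor r k

embedFactor≥1 : ∀ {r} k → 1 ≤ r → 1 ≤ embedFactor r k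
embedFactor≥1 zero _ = s≤s z≤n
embedFactor≥1 {r} (suc k) 1≤r = ℕₚ.*-mono-≤ (ℕₚ.≤-trans 1≤r (ℕₚ.m≤m+n r k)) (embedFactor≥1 k 1≤r)

pairFactor : ℕ → ℕ → ℕ
pairFactor h r = h * embedFactor r h

-- A block is cut out by two prunings. Each divides the sparsity by 4, hence `4 * (4 * r)`, and
-- halves the remaining set, hence the outer 4. The `suc` leaves at least `M` vertices at every
-- stage, even where the rest of the factor vanishes.
blockFactor : ℕ → ℕ → ℕ → ℕ
blockFactor h r zero = 1
blockFactor h r (suc k) = pairFactor h (4 * (4 * r)) * (4 * suc (blockFactor h r k))

module Sparse {A : Set} (E : A → A → Bool) where

  arc : Bool → A → A → Bool
  arc true = E
  arc false = flip E

  Respects : ∀ {k} → (Fin k → Fin k → Bool) → (Fin k → A) → Set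
  Respects e x = ∀ i j → i Fin.< j → arc (e i j) (x i) (x j) ≡ true

  SparseTo : ℕ → Bool → List A → List A → Set
  SparseTo r b xs ys = ∀ {x} → x ∈ xs → r * count (arc b x) ys ≤ length ys

  SparsePair : ℕ → ℕ → (List A → List A → Set) → Set
  SparsePair r m Q = Σ (List A) λ xs → Σ (List A) λ ys → Q xs ys × Unique xs × Unique ys × Apart xs ys ×
    m ≤ length xs × m ≤ length ys × ∃ λ b → SparseTo r b xs ys

  -- Greedy embedding: the image of vertex 0 must leave a 1/r fraction of every other
  -- candidate set; if no choice does, by pigeonhole many vertices of V 0 are sparse to one V j.
  embed-or-sparse : ∀ k (e : Fin k → Fin k → Bool) {r m} → 1 ≤ r → 1 ≤ m → (V : Fin k → List A) →
    (∀ i → embedFactor r k * m ≤ length (V i)) → (∀ i → Unique (V i)) →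
    (∀ {i j} → i ≢ j → Apart (V i) (V j)) →
    (Σ (Fin k → A) λ x → (∀ i → x i ∈ V i) × Respects e x)
    ⊎ SparsePair r m (λ xs ys → ∃ λ i → ∃ λ j → xs ⊆ V i × ys ⊆ V j)
  embed-or-sparse zero e 1≤r 1≤m V large uniq apart = inj₁ ((λ ()) , (λ ()) , λ ())
  embed-or-sparse (suc k) e {r} {m} 1≤r 1≤m V large uniq apart
    with Allᴸ.all? (λ x → Finₚ.any? (λ j → sparse? j x)) (V zero)
    where
    sparse? : ∀ j → Decidable (λ x → r * count (arc (e zero (suc j)) x) (V (suc j)) ≤ length (V (suc j)))
    sparse? j = sparse-at? (arc (e zero (suc j))) r (V (suc j))
  ... | yes all-sparse = inj₂ (xs , V (suc j) , (zero , suc j , filter-⊆ _ (V zero) , λ y∈ → y∈) ,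
          Uniqueₚ.filter⁺ (sparse? j) (uniq zero) , uniq (suc j) ,
          (λ x∈ y∈ → apart {zero} {suc j} (λ ()) (filter-⊆ (sparse? j) (V zero) x∈) y∈) ,
          ℕₚ.≤-trans m≤ (proj₂ hit) ,
          ℕₚ.≤-trans (ℕₚ.≤-trans m≤ (ℕₚ.*-monoˡ-≤ m (ℕₚ.≤-trans (ℕₚ.≤-reflexive (sym (ℕₚ.*-identityˡ _)))
             (ℕₚ.*-monoˡ-≤ (embedFactor r k) (ℕₚ.≤-trans 1≤r (ℕₚ.m≤m+n r k)))))) (large (suc j)) ,
          e zero (suc j) , λ x∈ → proj₂ (∈ₚ.∈-filter⁻ (sparse? j) {xs = V zero} x∈))
    where
    sparse? : ∀ j → Decidable (λ x → r * count (arc (e zero (suc j)) x) (V (suc j)) ≤ length (V (suc j)))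
    sparse? j = sparse-at? (arc (e zero (suc j))) r (V (suc j))
    s = embedFactor r k
    m≤ : m ≤ s * m
    m≤ = subst (_≤ s * m) (ℕₚ.*-identityˡ m) (ℕₚ.*-monoˡ-≤ m (embedFactor≥1 k 1≤r))
    hit = pigeonhole k sparse? (s * m) (V zero) (Allᴸ.lookup all-sparse)
      (ℕₚ.≤-trans (ℕₚ.*-mono-≤ (embedFactor≥1 (suc k) 1≤r) 1≤m) (large zero))
      (ℕₚ.≤-trans (ℕₚ.≤-trans (ℕₚ.≤-reflexive (sym (ℕₚ.*-assoc k s m)))
        (ℕₚ.*-monoˡ-≤ m (ℕₚ.*-monoˡ-≤ s (ℕₚ.m≤n+m k r)))) (large zero))
    j = proj₁ hit
    xs = filter (sparse? j) (V zero)
  ... | no ¬all with find (Allₚ.¬All⇒Any¬ (λ x → Finₚ.any? (λ j → sparse-at? (arc (e zero (suc j))) r (V (suc j)) x)) (V zero) ¬all)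
  ... | x₀ , x₀∈ , dense = extend (embed-or-sparse k (λ i j → e (suc i) (suc j)) 1≤r 1≤m V′ large′
          (λ j → Uniqueₚ.filter⁺ (nbr? j) (uniq (suc j)))
          (λ {i} {j} i≢j y∈ z∈ → apart {suc i} {suc j} (i≢j ∘ Finₚ.suc-injective) (V′⊆ i y∈) (V′⊆ j z∈)))
    where
    nbr? : ∀ j → Decidable (λ y → arc (e zero (suc j)) x₀ y ≡ true)
    nbr? j y = arc (e zero (suc j)) x₀ y 𝔹ₚ.≟ true
    V′ : Fin k → List A
    V′ j = filter (nbr? j) (V (suc j))
    V′⊆ : ∀ j → V′ j ⊆ V (suc j)
    V′⊆ j = filter-⊆ (nbr? j) (V (suc j))
    large′ : ∀ j → embedFactor r k * m ≤ length (V′ j)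
    large′ j = ℕₚ.*-cancelˡ-≤ r {{>-nonZero 1≤r}} (begin
      r * (embedFactor r k * m) ≡⟨ ℕₚ.*-assoc r _ m ⟨
      r * embedFactor r k * m ≤⟨ ℕₚ.*-monoˡ-≤ m (ℕₚ.*-monoˡ-≤ (embedFactor r k) (ℕₚ.m≤m+n r k)) ⟩
      (r + k) * embedFactor r k * m ≤⟨ large (suc j) ⟩
      length (V (suc j)) ≤⟨ ℕₚ.<⇒≤ (ℕₚ.≰⇒> (λ h → dense (j , h))) ⟩
      r * count (arc (e zero (suc j)) x₀) (V (suc j)) ≡⟨ cong (r *_) (count-filter _ (V (suc j))) ⟩
      r * length (V′ j) ∎)
      where open ℕₚ.≤-Reasoning
    extend : (Σ (Fin k → A) λ x → (∀ i → x i ∈ V′ i) × Respects (λ i j → e (suc i) (suc j)) x)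
      ⊎ SparsePair r m (λ xs ys → ∃ λ i → ∃ λ j → xs ⊆ V′ i × ys ⊆ V′ j) →
      (Σ (Fin (suc k) → A) λ x → (∀ i → x i ∈ V i) × Respects e x)
      ⊎ SparsePair r m (λ xs ys → ∃ λ i → ∃ λ j → xs ⊆ V i × ys ⊆ V j)
    extend (inj₂ (xs , ys , (i , j , xs⊆ , ys⊆) , rest)) =
      inj₂ (xs , ys , (suc i , suc j , (λ x∈ → V′⊆ i (xs⊆ x∈)) , λ y∈ → V′⊆ j (ys⊆ y∈)) , rest)
    extend (inj₁ (x , x∈ , resp)) = inj₁ (x′ , x′∈ , resp′)
      where
      x′ : Fin (suc k) → A
      x′ zero = x₀
      x′ (suc i) = x i
      x′∈ : ∀ i → x′ i ∈ V i
      x′∈ zero = x₀∈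
      x′∈ (suc i) = V′⊆ i (x∈ i)
      resp′ : Respects e x′
      resp′ zero (suc j) _ = proj₂ (∈ₚ.∈-filter⁻ (nbr? j) {xs = V (suc j)} (x∈ j))
      resp′ (suc i) (suc j) (s≤s i<j) = resp i j i<j

  -- A transitive set listed in its order. In this form consecutive segments are automatically
  -- complete to the later ones, as the parts `S_{i,a}` must be.
  Chain : List A → Set
  Chain = AllPairs (λ x y → E x y ≡ true)

  -- For disjoint nonempty sets in a tournament this is `d(xs, ys) ≥ 1 - 1/r`, expressed by the
  -- backward edges because those are what sparsity bounds.
  FewBack : ℕ → List A → List A → Set
  FewBack r xs ys = r * ∑ (λ x → count (λ y → E y x) ys) xs ≤ length xs * length ys

  -- A block carries both a large set B and a chain P inside it: new blocks are attached at either end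
  -- of the sequence, so the entry of v that a block will serve is known only once all are built.
  Block = List A × List A

  -- The size is exactly `2 * M`, so that each of `ℓ` disjoint blocks is exactly a `1/ℓ` fraction of
  -- their union. The 2 leaves `M` vertices in which to choose `P` after pruning has halved `B`.
  IsBlock : ℕ → ℕ → List A → Block → Set
  IsBlock M L X (B , P) = Unique B × length B ≡ 2 * M × B ⊆ X × Chain P × L ≤ length P × P ⊆ B

  Before : ℕ → Block → Block → Set
  Before r (B , P) (B′ , P′) = Apart B B′ × FewBack r B B′ × FewBack r B P′ × FewBack r P B′ × FewBack r P P′

  sparse⇒FewBack : ∀ {r} xs ys → SparseTo r false xs ys → FewBack r xs ys
  sparse⇒FewBack {r} xs ys h = begin
    r * ∑ (λ x → count (λ y → E y x) ys) xs ≡⟨ ∑-* r _ xs ⟨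
    ∑ (λ x → r * count (λ y → E y x) ys) xs ≤⟨ ∑-mono xs h ⟩
    ∑ (λ _ → length ys) xs ≡⟨ ∑-const (length ys) xs ⟩
    length xs * length ys ∎
    where open ℕₚ.≤-Reasoning

  sparse⇒FewBack-flip : ∀ {r} xs ys → SparseTo r true xs ys → FewBack r ys xs
  sparse⇒FewBack-flip {r} xs ys h = begin
    r * ∑ (λ y → count (λ x → E x y) xs) ys ≡⟨ cong (r *_) (∑-swap (λ x y → b2n (E x y)) xs ys) ⟨
    r * ∑ (λ x → count (E x) ys) xs ≡⟨ ∑-* r _ xs ⟨
    ∑ (λ x → r * count (E x) ys) xs ≤⟨ ∑-mono xs h ⟩
    ∑ (λ _ → length ys) xs ≡⟨ ∑-const (length ys) xs ⟩
    length xs * length ys ≡⟨ ℕₚ.*-comm (length xs) _ ⟩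
    length ys * length xs ∎
    where open ℕₚ.≤-Reasoning

  SparseTo-⊆ : ∀ {r r′ b xs xs′ ys} → r ≤ r′ → xs ⊆ xs′ → SparseTo r′ b xs′ ys → SparseTo r b xs ys
  SparseTo-⊆ r≤r′ xs⊆ h x∈ = ℕₚ.≤-trans (ℕₚ.*-monoˡ-≤ _ r≤r′) (h (xs⊆ x∈))

  -- Restricting ys to its vertices of small degree first makes the sparsity survive, for most of
  -- xs, the passage to an arbitrary further subset of ys.
  prune : ∀ {r} b xs {ys} {Q : List A → Set} → Unique xs → Unique ys → SparseTo (4 * r) b xs ys →
    (∀ ys′ → ys′ ⊆ ys → Unique ys′ → length ys ≤ 2 * length ys′ → ∃ λ zs → zs ⊆ ys′ × Q zs) →
    Σ (List A) λ zs → Σ (List A) λ xs′ → zs ⊆ ys × Q zs × xs′ ⊆ xs × Unique xs′ ×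
      length xs ≤ 2 * length xs′ × SparseTo r b xs′ zs
  prune {r} b xs {ys} ux uy sp choose = zs , filter xs? xs , (λ z∈ → filter-⊆ ys? ys (zs⊆ z∈)) ,
      proj₂ (proj₂ chosen) , filter-⊆ xs? xs , Uniqueₚ.filter⁺ xs? ux ,
      halve (arc b) r xs zs (λ z∈ → proj₂ (∈ₚ.∈-filter⁻ ys? {xs = ys} (zs⊆ z∈))) ,
      (λ x∈ → proj₂ (∈ₚ.∈-filter⁻ xs? {xs = xs} x∈))
    where
    -- Each of the two uses of `halve` gives up a factor 2 of the sparsity: `4 * r` becomes `2 * r`
    -- here and `r` at `xs?`.
    ys? = sparse-at? (flip (arc b)) (2 * r) xs
    half-ys : length ys ≤ 2 * length (filter ys? ys)
    half-ys = halve (flip (arc b)) (2 * r) ys xs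
      (λ {x} x∈ → subst (λ z → z * count (arc b x) ys ≤ length ys) (ℕₚ.*-assoc 2 2 r) (sp x∈))
    chosen = choose (filter ys? ys) (filter-⊆ ys? ys) (Uniqueₚ.filter⁺ ys? uy) half-ys
    zs = proj₁ chosen
    zs⊆ : zs ⊆ filter ys? ys
    zs⊆ = proj₁ (proj₂ chosen)
    xs? = sparse-at? (arc b) r zs

  module Blocks {h : ℕ} {e : Fin h → Fin h → Bool} (free : ∀ (x : Fin h → A) → ¬ Respects e x) where

    sparse-pair : ∀ {r m} X → 1 ≤ r → 1 ≤ m → Unique X → pairFactor h r * m ≤ length X →
      SparsePair r m (λ xs ys → xs ⊆ X × ys ⊆ X)
    sparse-pair {r} {m} X 1≤r 1≤m u large
      with segments h (embedFactor r h * m) X u (subst (_≤ length X) (ℕₚ.*-assoc h _ m) large)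
    ... | V , bigV , sub , uniq , apart with embed-or-sparse h e 1≤r 1≤m V bigV uniq apart
    ... | inj₁ (x , _ , resp) = ⊥-elim (free x resp)
    ... | inj₂ (xs , ys , (i , j , xs⊆ , ys⊆) , rest) = xs , ys , ((λ x∈ → sub i (xs⊆ x∈)) , λ y∈ → sub j (ys⊆ y∈)) , rest

    module _ {M L : ℕ} (1≤M : 1 ≤ M)
             (select : ∀ Y → Unique Y → length Y ≡ M → ∃ λ P → Chain P × L ≤ length P × P ⊆ Y) where

      Split : ℕ → ℕ → List A → Set
      Split r m X = Σ (List A) λ X′ → Σ (List A) λ B → Σ (List A) λ P → IsBlock M L X (B , P) × X′ ⊆ X ×
        Unique X′ × Apart X′ B × m ≤ length X′ × ∃ λ b → SparseTo r b X′ B × SparseTo r b X′ P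

      -- The first pruning of a sparse pair fixes `B`, the second fixes the chain `P` within the
      -- surviving half of `B`. The other side of the pair, halved twice, becomes `X′` and stays
      -- sparse to both.
      split : ∀ {r m} X → 1 ≤ r → M ≤ m → Unique X → pairFactor h (4 * (4 * r)) * (4 * m) ≤ length X → Split r m X
      split {r} {m} X 1≤r M≤m u large = from-pair (sparse-pair X
          (ℕₚ.≤-trans (ℕₚ.≤-trans 1≤r (ℕₚ.m≤m+n r _)) (ℕₚ.m≤m+n (4 * r) _))
          (ℕₚ.≤-trans (ℕₚ.≤-trans 1≤M M≤m) (ℕₚ.m≤m+n m _)) u large)
        where
        from-pair : SparsePair (4 * (4 * r)) (4 * m) (λ xs ys → xs ⊆ X × ys ⊆ X) → Split r m X
        from-pair (A₀ , B₀ , (A₀⊆ , B₀⊆) , uA₀ , uB₀ , apart , 4m≤A₀ , 4m≤B₀ , b , sp) =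
          from-B (prune {4 * r} b A₀ uA₀ uB₀ sp chooseB)
          where
          chooseB : ∀ ys → ys ⊆ B₀ → Unique ys → length B₀ ≤ 2 * length ys →
            ∃ λ zs → zs ⊆ ys × Unique zs × length zs ≡ 2 * M
          chooseB ys _ uy half = take (2 * M) ys , take-⊆ (2 * M) ys , Uniqueₚ.take⁺ (2 * M) uy ,
            length-take-≤ (ℕₚ.*-cancelˡ-≤ 2 (ℕₚ.≤-trans (ℕₚ.≤-reflexive (sym (ℕₚ.*-assoc 2 2 M)))
              (ℕₚ.≤-trans (ℕₚ.*-monoʳ-≤ 4 M≤m) (ℕₚ.≤-trans 4m≤B₀ half))))
          from-B : (Σ (List A) λ B → Σ (List A) λ A₁ → B ⊆ B₀ × (Unique B × length B ≡ 2 * M) × A₁ ⊆ A₀ ×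
            Unique A₁ × length A₀ ≤ 2 * length A₁ × SparseTo (4 * r) b A₁ B) → Split r m X
          from-B (B , A₁ , B⊆B₀ , (uB , lB) , A₁⊆A₀ , uA₁ , half₀ , sp₁) = from-P (prune {r} b A₁ uA₁ uB sp₁ chooseP)
            where
            chooseP : ∀ ys → ys ⊆ B → Unique ys → length B ≤ 2 * length ys →
              ∃ λ zs → zs ⊆ ys × Chain zs × L ≤ length zs
            chooseP ys _ uy half = proj₁ sel , (λ x∈ → take-⊆ M ys (proj₂ (proj₂ (proj₂ sel)) x∈)) ,
              proj₁ (proj₂ sel) , proj₁ (proj₂ (proj₂ sel))
              where
              sel = select (take M ys) (Uniqueₚ.take⁺ M uy)
                (length-take-≤ (ℕₚ.*-cancelˡ-≤ 2 (subst (_≤ 2 * length ys) lB half)))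
            from-P : (Σ (List A) λ P → Σ (List A) λ A₂ → P ⊆ B × (Chain P × L ≤ length P) × A₂ ⊆ A₁ ×
              Unique A₂ × length A₁ ≤ 2 * length A₂ × SparseTo r b A₂ P) → Split r m X
            from-P (P , A₂ , P⊆B , (ch , L≤) , A₂⊆A₁ , uA₂ , half₁ , sp₂) =
              A₂ , B , P , (uB , lB , (λ x∈ → B₀⊆ (B⊆B₀ x∈)) , ch , L≤ , P⊆B) ,
              (λ x∈ → A₀⊆ (A₁⊆A₀ (A₂⊆A₁ x∈))) , uA₂ , (λ x∈ y∈ → apart (A₁⊆A₀ (A₂⊆A₁ x∈)) (B⊆B₀ y∈)) ,
              ℕₚ.*-cancelˡ-≤ 4 (ℕₚ.≤-trans 4m≤A₀ (ℕₚ.≤-trans half₀ (ℕₚ.≤-trans (ℕₚ.*-monoʳ-≤ 2 half₁)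
                (ℕₚ.≤-reflexive (sym (ℕₚ.*-assoc 2 2 (length A₂))))))) ,
              b , SparseTo-⊆ {b = b} {xs′ = A₁} {ys = B} (ℕₚ.m≤m+n r _) A₂⊆A₁ sp₁ , sp₂

      Sequence : ℕ → ℕ → List A → Set
      Sequence r k X = Σ (List Block) λ bs → length bs ≡ k × Allᴸ (IsBlock M L X) bs × AllPairs (Before r) bs

      -- All further blocks are built inside `X′`. Every vertex of `X′` is sparse to `B` and to `P`,
      -- so the bounds hold for any subset of `X′` found later. Few edges from `X′` to `B` put the
      -- new block in front of the others, few edges from `B` to `X′` put it behind them.
      block-sequence : ∀ k {r} X → 1 ≤ r → Unique X → blockFactor h r k * M ≤ length X → Sequence r k X
      block-sequence zero X 1≤r u large = [] , refl , [] , []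
      block-sequence (suc k) {r} X 1≤r u large = from-split (split X 1≤r (ℕₚ.m≤m+n M _) u
          (subst (_≤ length X) (trans (ℕₚ.*-assoc (pairFactor h (4 * (4 * r))) _ M)
            (cong (pairFactor h (4 * (4 * r)) *_) (ℕₚ.*-assoc 4 (suc (blockFactor h r k)) M))) large))
        where
        from-split : Split r (suc (blockFactor h r k) * M) X → Sequence r (suc k) X
        from-split (X′ , B , P , isB , X′⊆X , uX′ , apart , bigX′ , b , spB , spP) =
          place b spB spP (block-sequence k X′ 1≤r uX′ (ℕₚ.≤-trans (ℕₚ.m≤n+m _ M) bigX′))
          where
          weaken : Allᴸ (IsBlock M L X′) ⊆ₚ Allᴸ (IsBlock M L X)
          weaken = Allᴸ.map (λ { (u , l , B⊆ , rest) → u , l , (λ x∈ → X′⊆X (B⊆ x∈)) , rest })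
          place : ∀ b → SparseTo r b X′ B → SparseTo r b X′ P → Sequence r k X′ → Sequence r (suc k) X
          place true spB spP (bs , len , ok , before) = (B , P) ∷ bs , cong suc len , isB ∷ weaken ok ,
            Allᴸ.map earlier ok ∷ before
            where
            earlier : ∀ {β} → IsBlock M L X′ β → Before r (B , P) β
            earlier {B′ , P′} (_ , _ , B′⊆ , _ , _ , P′⊆) = (λ x∈ y∈ → apart (B′⊆ y∈) x∈) ,
              sparse⇒FewBack-flip {r} B′ B (λ x∈ → spB (B′⊆ x∈)) ,
              sparse⇒FewBack-flip {r} P′ B (λ x∈ → spB (B′⊆ (P′⊆ x∈))) ,
              sparse⇒FewBack-flip {r} B′ P (λ x∈ → spP (B′⊆ x∈)) ,
              sparse⇒FewBack-flip {r} P′ P (λ x∈ → spP (B′⊆ (P′⊆ x∈)))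
          place false spB spP (bs , len , ok , before) = bs ++ (B , P) ∷ [] ,
            trans (Listₚ.length-++ bs) (trans (ℕₚ.+-comm _ 1) (cong suc len)) ,
            Allₚ.++⁺ (weaken ok) (isB ∷ []) , AllPairsₚ.++⁺ before ([] ∷ []) (Allᴸ.map (λ p → later p ∷ []) ok)
            where
            later : ∀ {β} → IsBlock M L X′ β → Before r β (B , P)
            later {B′ , P′} (_ , _ , B′⊆ , _ , _ , P′⊆) = (λ x∈ y∈ → apart (B′⊆ x∈) y∈) ,
              sparse⇒FewBack {r} B′ B (λ x∈ → spB (B′⊆ x∈)) ,
              sparse⇒FewBack {r} B′ P (λ x∈ → spP (B′⊆ x∈)) ,
              sparse⇒FewBack {r} P′ B (λ x∈ → spB (B′⊆ (P′⊆ x∈))) ,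
              sparse⇒FewBack {r} P′ P (λ x∈ → spP (B′⊆ (P′⊆ x∈)))

-- Subsets as duplicate-free lists

fromList : ∀ {n} → List (Fin n) → Subset n
fromList [] = Subset.⊥
fromList (x ∷ xs) = fromList xs Vec.[ x ]≔ true

∈-fromList⁺ : ∀ {n} {x : Fin n} {xs} → x ∈ xs → x Subset.∈ fromList xs
∈-fromList⁺ {x = x} {y ∷ xs} (here refl) = Vecₚ.lookup⇒[]= x _ (Vecₚ.lookup∘update x (fromList xs) true)
∈-fromList⁺ {x = x} {y ∷ xs} (there x∈) with x Finₚ.≟ y
... | yes refl = Vecₚ.lookup⇒[]= x _ (Vecₚ.lookup∘update x (fromList xs) true)
... | no x≢y = Vecₚ.lookup⇒[]= x _ (trans (Vecₚ.lookup∘update′ x≢y (fromList xs) true) (Vecₚ.[]=⇒lookup (∈-fromList⁺ x∈)))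

∈-fromList⁻ : ∀ {n} {x : Fin n} {xs} → x Subset.∈ fromList xs → x ∈ xs
∈-fromList⁻ {xs = []} x∈ = ⊥-elim (Subsetₚ.∉⊥ x∈)
∈-fromList⁻ {x = x} {y ∷ xs} x∈ with x Finₚ.≟ y
... | yes refl = here refl
... | no x≢y = there (∈-fromList⁻ (Vecₚ.lookup⇒[]= x _ (trans (sym (Vecₚ.lookup∘update′ x≢y (fromList xs) true)) (Vecₚ.[]=⇒lookup x∈))))

∉-fromList : ∀ {n} {x : Fin n} {xs} → x ∉ xs → Vec.lookup (fromList xs) x ≡ false
∉-fromList {x = x} {xs} x∉ with Vec.lookup (fromList xs) x in eq
... | false = refl
... | true = contradiction (∈-fromList⁻ (Vecₚ.lookup⇒[]= x _ eq)) x∉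

-- The common shape of cardinalities and of the nested sums in `edges`, through which both become
-- list sums.
subsetSum : ∀ {n} → Subset n → (Fin n → ℕ) → ℕ
subsetSum p f = Vec.sum (tabulate λ i → if Vec.lookup p i then f i else 0)

subsetSum-⊥ : ∀ {n} (f : Fin n → ℕ) → subsetSum Subset.⊥ f ≡ 0
subsetSum-⊥ {zero} f = refl
subsetSum-⊥ {suc n} f = subsetSum-⊥ (f ∘ suc)

subsetSum-insert : ∀ {n} (p : Subset n) x f → Vec.lookup p x ≡ false →
  subsetSum (p Vec.[ x ]≔ true) f ≡ f x + subsetSum p f
subsetSum-insert (false ∷ p) zero f refl = refl
subsetSum-insert (b ∷ p) (suc x) f eq = trans
  (cong ((if b then f zero else 0) +_) (subsetSum-insert p x (f ∘ suc) eq))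
  (solve 3 (λ a b c → a :+ (b :+ c) := b :+ (a :+ c)) refl (if b then f zero else 0) (f (suc x)) (subsetSum p (f ∘ suc)))
  where open +-*-Solver

subsetSum-fromList : ∀ {n} {xs : List (Fin n)} f → Unique xs → subsetSum (fromList xs) f ≡ ∑ f xs
subsetSum-fromList {xs = []} f _ = subsetSum-⊥ f
subsetSum-fromList {xs = x ∷ xs} f (x∉ ∷ u) = trans
  (subsetSum-insert (fromList xs) x f (∉-fromList {xs = xs} (λ x∈ → Allᴸ.lookup x∉ x∈ refl)))
  (cong (f x +_) (subsetSum-fromList f u))

∣p∣-subsetSum : ∀ {n} (p : Subset n) → ∣ p ∣ ≡ subsetSum p (λ _ → 1)
∣p∣-subsetSum [] = refl
∣p∣-subsetSum (true ∷ p) = cong suc (∣p∣-subsetSum p)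
∣p∣-subsetSum (false ∷ p) = ∣p∣-subsetSum p

∣fromList∣ : ∀ {n} {xs : List (Fin n)} → Unique xs → ∣ fromList xs ∣ ≡ length xs
∣fromList∣ {xs = xs} u = trans (∣p∣-subsetSum (fromList xs)) (trans (subsetSum-fromList _ u)
  (trans (∑-const 1 xs) (ℕₚ.*-identityʳ _)))

⋃-fromList : ∀ {n} (xss : List (List (Fin n))) → ⋃ (map fromList xss) ≡ fromList (concat xss)
⋃-fromList xss = Subsetₚ.⊆-antisym (to xss) (from xss)
  where
  to : ∀ xss → ⋃ (map fromList xss) Subset.⊆ fromList (concat xss)
  to [] x∈ = ⊥-elim (Subsetₚ.∉⊥ x∈)
  to (xs ∷ xss) x∈ with Subsetₚ.x∈p∪q⁻ (fromList xs) _ x∈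
  ... | inj₁ h = ∈-fromList⁺ (∈ₚ.∈-++⁺ˡ {xs = xs} (∈-fromList⁻ h))
  ... | inj₂ h = ∈-fromList⁺ (∈ₚ.∈-++⁺ʳ xs (∈-fromList⁻ {xs = concat xss} (to xss h)))
  from : ∀ xss → fromList (concat xss) Subset.⊆ ⋃ (map fromList xss)
  from [] x∈ = x∈
  from (xs ∷ xss) x∈ with ∈ₚ.∈-++⁻ xs (∈-fromList⁻ x∈)
  ... | inj₁ h = Subsetₚ.x∈p∪q⁺ (inj₁ (∈-fromList⁺ h))
  ... | inj₂ h = Subsetₚ.x∈p∪q⁺ (inj₂ (from xss (∈-fromList⁺ h)))

elems : ∀ {n} → Subset n → List (Fin n)
elems [] = []
elems (true ∷ p) = zero ∷ map suc (elems p)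
elems (false ∷ p) = map suc (elems p)

∈-elems⁻ : ∀ {n} (p : Subset n) {x} → x ∈ elems p → x Subset.∈ p
∈-elems⁻ (true ∷ p) (here refl) = Vec.here
∈-elems⁻ (true ∷ p) (there x∈) with ∈ₚ.∈-map⁻ suc x∈
... | y , y∈ , refl = Vec.there (∈-elems⁻ p y∈)
∈-elems⁻ (false ∷ p) x∈ with ∈ₚ.∈-map⁻ suc x∈
... | y , y∈ , refl = Vec.there (∈-elems⁻ p y∈)

elems-unique : ∀ {n} (p : Subset n) → Unique (elems p)
elems-unique [] = []
elems-unique (true ∷ p) = Allᴸ.tabulate (λ {y} y∈ → λ { refl → zero∉ y∈ }) ∷ Uniqueₚ.map⁺ Finₚ.suc-injective (elems-unique p)
  where
  zero∉ : zero ∉ map suc (elems p)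
  zero∉ z∈ with ∈ₚ.∈-map⁻ suc z∈
  ... | _ , _ , ()
elems-unique (false ∷ p) = Uniqueₚ.map⁺ Finₚ.suc-injective (elems-unique p)

length-elems : ∀ {n} (p : Subset n) → length (elems p) ≡ ∣ p ∣
length-elems [] = refl
length-elems (true ∷ p) = cong suc (trans (Listₚ.length-map suc (elems p)) (length-elems p))
length-elems (false ∷ p) = trans (Listₚ.length-map suc (elems p)) (length-elems p)

-- Transitive sets as chains

module _ (T : Tournament) where

  asym : ∀ {a b} → E T a b ≡ true → E T b a ≡ true → ⊥
  asym {a} {b} ab ba with a Finₚ.≟ b
  ... | yes refl = contradiction (trans (sym ab) (irrefl T a)) λ ()
  ... | no a≢b with trans (sym ba) (trans (tourn T b a (a≢b ∘ sym)) (cong not ab))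
  ... | ()

  total : ∀ {a b} → a ≢ b → E T a b ≢ true → E T b a ≡ true
  total {a} {b} a≢b ¬ab = trans (tourn T b a (a≢b ∘ sym)) (cong not (𝔹ₚ.¬-not ¬ab))

  edges-fromList : ∀ {xs ys} → Unique xs → Unique ys →
    edges T (fromList xs) (fromList ys) ≡ ∑ (λ x → count (E T x) ys) xs
  edges-fromList {xs} {ys} ux uy = trans
    (cong Vec.sum (Vecₚ.tabulate-cong (λ x → row x (Vec.lookup (fromList xs) x))))
    (subsetSum-fromList (λ x → count (E T x) ys) ux)
    where
    zeros-sum : ∀ n → Vec.sum (tabulate {n = n} (λ _ → 0)) ≡ 0
    zeros-sum zero = refl
    zeros-sum (suc n) = zeros-sum n
    cell : ∀ b c → (if b ∧ c then 1 else 0) ≡ (if b then b2n c else 0)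
    cell true c = refl
    cell false c = refl
    row : ∀ x b → Vec.sum (tabulate λ y → if b ∧ Vec.lookup (fromList ys) y ∧ E T x y then 1 else 0)
      ≡ (if b then count (E T x) ys else 0)
    row x false = zeros-sum (size T)
    row x true = trans (cong Vec.sum (Vecₚ.tabulate-cong (λ y → cell (Vec.lookup (fromList ys) y) (E T x y))))
      (subsetSum-fromList (b2n ∘ E T x) uy)

  Chain : List (Fin (size T)) → Set
  Chain = AllPairs (λ x y → E T x y ≡ true)

  Chain⇒Unique : ∀ {xs} → Chain xs → Unique xs
  Chain⇒Unique = AllPairs.map (λ { e refl → asym e e })

  -- In a tournament, having no directed cycle amounts to transitivity of the edge relation. This
  -- form speaks of triples only, so it is decidable, which finding `tr(T)` requires.
  ClosedOn : Subset (size T) → Set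
  ClosedOn S = ∀ a b c → a Subset.∈ S → b Subset.∈ S → c Subset.∈ S →
    E T a b ≡ true → E T b c ≡ true → E T a c ≡ true

  -- Closure contracts the path from `f zero` to the last vertex into a single edge, which opposes
  -- the closing edge of the cycle.
  closed⇒transitive : ∀ {S} → ClosedOn S → TransitiveSet T S
  closed⇒transitive closed (zero , f , _ , f∈ , path , back) = asym back back
  closed⇒transitive {S} closed (suc k , f , _ , f∈ , path , back) = asym back (reach k f f∈ path)
    where
    reach : ∀ k (f : Fin (suc (suc k)) → Fin (size T)) → (∀ i → f i Subset.∈ S) →
      (∀ i → E T (f (inject₁ i)) (f (suc i)) ≡ true) → E T (f zero) (f (fromℕ (suc k))) ≡ true
    reach zero f f∈ path = path zero
    reach (suc k) f f∈ path = closed _ _ _ (f∈ _) (f∈ _) (f∈ _) (path zero) (reach k (f ∘ suc) (f∈ ∘ suc) (path ∘ suc))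

  -- A failure of closure is a directed triangle.
  transitive⇒closed : ∀ {S} → TransitiveSet T S → ClosedOn S
  transitive⇒closed {S} tr a b c a∈ b∈ c∈ ab bc with E T a c in ac
  ... | true = refl
  ... | false = ⊥-elim (tr (2 , f , inj , f∈ , path , ca))
    where
    a≢c : a ≢ c
    a≢c refl = asym ab bc
    ca : E T c a ≡ true
    ca = total a≢c (λ e → contradiction (trans (sym ac) e) λ ())
    f : Fin 3 → Fin (size T)
    f zero = a
    f (suc zero) = b
    f (suc (suc zero)) = c
    f∈ : ∀ i → f i Subset.∈ S
    f∈ zero = a∈
    f∈ (suc zero) = b∈
    f∈ (suc (suc zero)) = c∈
    path : ∀ (i : Fin 2) → E T (f (inject₁ i)) (f (suc i)) ≡ true
    path zero = ab
    path (suc zero) = bc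
    inj : ∀ {i j} → f i ≡ f j → i ≡ j
    inj {zero} {zero} _ = refl
    inj {zero} {suc zero} refl = ⊥-elim (asym ab ab)
    inj {zero} {suc (suc zero)} a≡c = ⊥-elim (a≢c a≡c)
    inj {suc zero} {zero} refl = ⊥-elim (asym ab ab)
    inj {suc zero} {suc zero} _ = refl
    inj {suc zero} {suc (suc zero)} refl = ⊥-elim (asym bc bc)
    inj {suc (suc zero)} {zero} c≡a = ⊥-elim (a≢c (sym c≡a))
    inj {suc (suc zero)} {suc zero} refl = ⊥-elim (asym bc bc)
    inj {suc (suc zero)} {suc (suc zero)} _ = refl

  transitive? : Decidable (TransitiveSet T)
  transitive? S = map′ closed⇒transitive transitive⇒closed
    (Finₚ.all? λ a → Finₚ.all? λ b → Finₚ.all? λ c → (a Subsetₚ.∈? S) →-dec ((b Subsetₚ.∈? S) →-dec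
      ((c Subsetₚ.∈? S) →-dec ((E T a b 𝔹ₚ.≟ true) →-dec ((E T b c 𝔹ₚ.≟ true) →-dec (E T a c 𝔹ₚ.≟ true))))))

  -- The bound `size T` is lowered until it is attained; the empty set stops the descent at 0.
  tr-exists : ∃ λ t → IsTr T t
  tr-exists = search (size T) (λ S _ → Subsetₚ.∣p∣≤n S)
    where
    search : ∀ k → (∀ S → TransitiveSet T S → ∣ S ∣ ≤ k) → ∃ λ t → IsTr T t
    search k bound with Subsetₚ.anySubset? (λ S → transitive? S ×-dec (∣ S ∣ ℕₚ.≟ k))
    ... | yes attained = k , attained , bound
    search zero bound | no ¬attained = ⊥-elim (¬attained (Subset.⊥ ,
      (λ { (_ , f , _ , f∈ , _) → Subsetₚ.∉⊥ (f∈ zero) }) , Subsetₚ.∣⊥∣≡0 (size T)))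
    search (suc k) bound | no ¬attained =
      search k λ S tr → ℕₚ.≤-pred (ℕₚ.≤∧≢⇒< (bound S tr) (λ eq → ¬attained (S , tr , eq)))

  chain⇒transitive : ∀ {xs} → Chain xs → TransitiveSet T (fromList xs)
  chain⇒transitive ch = closed⇒transitive λ a b c a∈ b∈ c∈ →
    closed ch (∈-fromList⁻ a∈) (∈-fromList⁻ b∈) (∈-fromList⁻ c∈)
    where
    closed : ∀ {xs a b c} → Chain xs → a ∈ xs → b ∈ xs → c ∈ xs →
      E T a b ≡ true → E T b c ≡ true → E T a c ≡ true
    closed (p ∷ ch) (here refl) (here refl) _ ab bc = ⊥-elim (asym ab ab)
    closed (p ∷ ch) (here refl) (there b∈) (here refl) ab bc = ⊥-elim (asym ab bc)
    closed (p ∷ ch) (here refl) (there b∈) (there c∈) ab bc = Allᴸ.lookup p c∈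
    closed (p ∷ ch) (there a∈) (here refl) _ ab bc = ⊥-elim (asym ab (Allᴸ.lookup p a∈))
    closed (p ∷ ch) (there a∈) (there b∈) (here refl) ab bc = ⊥-elim (asym bc (Allᴸ.lookup p b∈))
    closed (p ∷ ch) (there a∈) (there b∈) (there c∈) ab bc = closed ch a∈ b∈ c∈ ab bc

  chain-≤ : ∀ {t xs} → IsTr T t → Chain xs → length xs ≤ t
  chain-≤ {t} (_ , bound) ch = subst (_≤ t) (∣fromList∣ (Chain⇒Unique ch)) (bound _ (chain⇒transitive ch))

  -- If `x` has an edge to the head, closure gives edges to the whole tail; otherwise the head has
  -- an edge to `x` and stays in front.
  insert : ∀ {S} → ClosedOn S → ∀ {x} xs → x Subset.∈ S → Allᴸ (Subset._∈ S) xs → x ∉ xs → Chain xs →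
    ∃ λ ys → Chain ys × length ys ≡ suc (length xs) × (∀ {z} → z ∈ ys → z ∈ x ∷ xs)
  insert closed {x} [] _ _ _ _ = x ∷ [] , [] ∷ [] , refl , λ z∈ → z∈
  insert closed {x} (y ∷ xs) x∈ (y∈ ∷ xs∈) x∉ (p ∷ ch) with E T x y 𝔹ₚ.≟ true
  ... | yes xy = x ∷ y ∷ xs , (xy ∷ Allᴸ.zipWith (λ { (z∈ , yz) → closed _ _ _ x∈ y∈ z∈ xy yz }) (xs∈ , p)) ∷ p ∷ ch ,
        refl , λ z∈ → z∈
  ... | no ¬xy with insert closed xs x∈ xs∈ (x∉ ∘ there) ch
  ... | ys , ch′ , len , ys⊆ = y ∷ ys , Allᴸ.tabulate (after ∘ ys⊆) ∷ ch′ , cong suc len , within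
    where
    after : ∀ {z} → z ∈ x ∷ xs → E T y z ≡ true
    after (here refl) = total (x∉ ∘ here) ¬xy
    after (there z∈) = Allᴸ.lookup p z∈
    within : ∀ {z} → z ∈ y ∷ ys → z ∈ x ∷ y ∷ xs
    within (here refl) = there (here refl)
    within (there z∈) with ys⊆ z∈
    ... | here refl = here refl
    ... | there z∈xs = there (there z∈xs)

  sort : ∀ {S} → ClosedOn S → ∀ xs → Allᴸ (Subset._∈ S) xs → Unique xs →
    ∃ λ ys → Chain ys × length ys ≡ length xs × (∀ {z} → z ∈ ys → z ∈ xs)
  sort closed [] _ _ = [] , [] , refl , λ z∈ → z∈
  sort closed (x ∷ xs) (x∈ ∷ xs∈) (x∉ ∷ u) with sort closed xs xs∈ u
  ... | ys , ch , len , ys⊆ with insert closed ys x∈ (Allᴸ.tabulate (Allᴸ.lookup xs∈ ∘ ys⊆)) (λ x∈ys → Allᴸ.lookup x∉ (ys⊆ x∈ys) refl) ch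
  ... | zs , ch′ , len′ , zs⊆ = zs , ch′ , trans len′ (cong suc len) , within
    where
    within : ∀ {z} → z ∈ zs → z ∈ x ∷ xs
    within z∈ with zs⊆ z∈
    ... | here refl = here refl
    ... | there z∈ys = there (ys⊆ z∈ys)

  transitive⇒chain : ∀ {S} → TransitiveSet T S →
    ∃ λ xs → Chain xs × length xs ≡ ∣ S ∣ × (∀ {z} → z ∈ xs → z Subset.∈ S)
  transitive⇒chain {S} tr with sort (transitive⇒closed tr) (elems S) (Allᴸ.tabulate (∈-elems⁻ S)) (elems-unique S)
  ... | xs , ch , len , xs⊆ = xs , ch , trans len (length-elems S) , ∈-elems⁻ S ∘ xs⊆

-- Ramsey bound, induced subtournaments and complete pairs

lookup-injective : ∀ {A : Set} {xs : List A} → Unique xs → ∀ i j → lookup xs i ≡ lookup xs j → i ≡ j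
lookup-injective (_ ∷ _) zero zero _ = refl
lookup-injective {xs = x ∷ xs} (x∉ ∷ _) zero (suc j) eq = contradiction eq (Allᴸ.lookup x∉ (∈ₚ.∈-lookup j))
lookup-injective {xs = x ∷ xs} (x∉ ∷ _) (suc i) zero eq = contradiction (sym eq) (Allᴸ.lookup x∉ (∈ₚ.∈-lookup i))
lookup-injective (_ ∷ u) (suc i) (suc j) eq = cong suc (lookup-injective u i j eq)

module _ (T : Tournament) where

  -- Of the at least `2 ^ (k + 1) - 1` vertices other than `x`, at least `2 ^ k` are out-neighbours
  -- or at least `2 ^ k` are in-neighbours; `x` extends a chain of the former at its beginning and
  -- of the latter at its end.
  ramsey : ∀ k xs → Unique xs → 2 ^ k ≤ length xs → ∃ λ ys → Chain T ys × suc k ≤ length ys × ys ⊆ xs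
  ramsey zero (x ∷ xs) u _ = x ∷ [] , [] ∷ [] , s≤s z≤n , λ { (here refl) → here refl }
  ramsey (suc k) [] u h = contradiction (ℕₚ.≤-trans (ℕₚ.m^n>0 2 (suc k)) h) λ ()
  ramsey (suc k) (x ∷ xs) (x∉ ∷ u) h = by-size (2 ^ k ≤? length out)
    where
    out? : Decidable (λ y → E T x y ≡ true)
    out? y = E T x y 𝔹ₚ.≟ true
    out = filter out? xs
    inn = filter (λ y → ¬? (out? y)) xs
    by-size : Dec (2 ^ k ≤ length out) → ∃ λ ys → Chain T ys × suc (suc k) ≤ length ys × ys ⊆ x ∷ xs
    by-size (yes large) with ramsey k out (Uniqueₚ.filter⁺ out? u) large
    ... | ys , ch , len , ys⊆ = x ∷ ys ,
      Allᴸ.tabulate (λ y∈ → proj₂ (∈ₚ.∈-filter⁻ out? {xs = xs} (ys⊆ y∈))) ∷ ch , s≤s len ,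
      λ { (here refl) → here refl ; (there y∈) → there (filter-⊆ out? xs (ys⊆ y∈)) }
    by-size (no small) with ramsey k inn (Uniqueₚ.filter⁺ (λ y → ¬? (out? y)) u) large
      where
      large : 2 ^ k ≤ length inn
      large = ℕₚ.+-cancelˡ-≤ (suc (length out)) _ _ (ℕₚ.≤-trans (ℕₚ.+-monoˡ-≤ (2 ^ k) (ℕₚ.≰⇒> small))
        (subst₂ _≤_ (cong (2 ^ k +_) (ℕₚ.+-identityʳ _)) (cong suc (sym (length-filter-compl out? xs))) h))
    ... | ys , ch , len , ys⊆ = ys ++ x ∷ [] ,
      AllPairsₚ.++⁺ ch ([] ∷ []) (Allᴸ.tabulate (λ y∈ → to-x (ys⊆ y∈) ∷ [])) ,
      subst (suc (suc k) ≤_) (sym (trans (Listₚ.length-++ ys) (ℕₚ.+-comm _ 1))) (s≤s len) , sub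
      where
      to-x : ∀ {y} → y ∈ inn → E T y x ≡ true
      to-x y∈ with ∈ₚ.∈-filter⁻ (λ y → ¬? (out? y)) {xs = xs} y∈
      ... | y∈xs , ¬xy = total T (Allᴸ.lookup x∉ y∈xs) ¬xy
      sub : ys ++ x ∷ [] ⊆ x ∷ xs
      sub z∈ with ∈ₚ.∈-++⁻ ys z∈
      ... | inj₁ z∈ys = there (filter-⊆ (λ y → ¬? (out? y)) xs (ys⊆ z∈ys))
      ... | inj₂ (here refl) = here refl

  induced : (xs : List (Fin (size T))) → Unique xs → Tournament
  induced xs u = record
    { size = length xs
    ; E = λ a b → E T (lookup xs a) (lookup xs b)
    ; irrefl = λ a → irrefl T (lookup xs a)
    ; tourn = λ a b a≢b → tourn T _ _ (a≢b ∘ lookup-injective u a b)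
    }

  induced-Contains : ∀ {H} xs u → Contains (induced xs u) H → Contains T H
  induced-Contains xs u (x , inj , resp) = lookup xs ∘ x , inj ∘ lookup-injective u _ _ , resp

  -- Pairs `i < j` suffice: an edge between two images, in whichever direction, makes them distinct,
  -- and `tourn` then settles the reversed pairs.
  respects⇒Contains : ∀ {H} (x : Fin (size H) → Fin (size T)) → Sparse.Respects (E T) (E H) x → Contains T H
  respects⇒Contains {H} x resp = x , inj , iso
    where
    forth : ∀ {i j} → i Fin.< j → E T (x i) (x j) ≡ E H i j
    forth {i} {j} i<j with E H i j | resp i j i<j
    ... | true | ij = ij
    ... | false | ji with E T (x i) (x j) in eq
    ... | true = ⊥-elim (asym T eq ji)
    ... | false = refl
    apart : ∀ {i j} → i Fin.< j → x i ≢ x j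
    apart {i} {j} i<j eq with E H i j | resp i j i<j
    ... | true | ij = contradiction (trans (sym ij) (trans (cong (E T (x i)) (sym eq)) (irrefl T (x i)))) λ ()
    ... | false | ji = contradiction (trans (sym ji) (trans (cong (E T (x j)) eq) (irrefl T (x j)))) λ ()
    inj : ∀ {i j} → x i ≡ x j → i ≡ j
    inj {i} {j} eq with Finₚ.<-cmp i j
    ... | tri< i<j _ _ = ⊥-elim (apart i<j eq)
    ... | tri≈ _ i≡j _ = i≡j
    ... | tri> _ _ j<i = ⊥-elim (apart j<i (sym eq))
    iso : ∀ i j → E T (x i) (x j) ≡ E H i j
    iso i j with Finₚ.<-cmp i j
    ... | tri< i<j _ _ = forth i<j
    ... | tri≈ _ refl _ = trans (irrefl T (x i)) (sym (irrefl H i))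
    ... | tri> _ i≢j j<i = trans (tourn T _ _ (apart j<i ∘ sym)) (trans (cong not (forth j<i)) (sym (tourn H i j i≢j)))

  edges-complement : ∀ {xs ys} → Apart xs ys →
    ∑ (λ x → count (E T x) ys) xs + ∑ (λ x → count (λ y → E T y x) ys) xs ≡ length xs * length ys
  edges-complement {xs} {ys} apart = trans (sym (∑-+ _ _ xs)) (trans (∑-cong xs row) (∑-const (length ys) xs))
    where
    cell : ∀ {x y} → x ≢ y → b2n (E T x y) + b2n (E T y x) ≡ 1
    cell {x} {y} x≢y with E T x y | E T y x | tourn T x y x≢y
    ... | true | false | _ = refl
    ... | false | true | _ = refl
    row : ∀ {x} → x ∈ xs → count (E T x) ys + count (λ y → E T y x) ys ≡ length ys
    row x∈ = trans (sym (∑-+ _ _ ys)) (trans (∑-cong ys (λ y∈ → cell (λ { refl → apart x∈ y∈ })))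
      (trans (∑-const 1 ys) (ℕₚ.*-identityʳ _)))

  complete-list : ∀ {xs ys} → Apart xs ys → ∑ (λ x → count (E T x) ys) xs ≡ length xs * length ys →
    ∀ {x y} → x ∈ xs → y ∈ ys → E T x y ≡ true
  complete-list {xs} {ys} apart eq {x} {y} x∈ y∈ =
    total T {y} {x} (λ { refl → apart x∈ y∈ }) (λ yx → contradiction (trans (sym (cong b2n yx)) (∑≡0 ys (∑≡0 xs none x∈) y∈)) λ ())
    where
    none : ∑ (λ x → count (λ y → E T y x) ys) xs ≡ 0
    none = ℕₚ.+-cancelˡ-≡ (length xs * length ys) _ _ (trans (cong (_+ ∑ (λ x → count (λ y → E T y x) ys) xs) (sym eq))
      (trans (edges-complement apart) (sym (ℕₚ.+-identityʳ _))))
    ∑≡0 : ∀ {f : Fin (size T) → ℕ} zs → ∑ f zs ≡ 0 → ∀ {z} → z ∈ zs → f z ≡ 0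
    ∑≡0 {f} (z ∷ zs) e (here refl) = ℕₚ.m+n≡0⇒m≡0 (f z) e
    ∑≡0 {f} (z ∷ zs) e (there z∈) = ∑≡0 zs (ℕₚ.m+n≡0⇒n≡0 (f z) e) z∈

-- Lifting lists and cutting them into parts

lift-⊆ : ∀ {A : Set} {xs ys : List A} → ys ⊆ xs → ∃ λ zs → map (lookup xs) zs ≡ ys
lift-⊆ {ys = []} _ = [] , refl
lift-⊆ {ys = y ∷ ys} ys⊆ with lift-⊆ {ys = ys} (ys⊆ ∘ there)
... | zs , eq = Any.index (ys⊆ (here refl)) ∷ zs , cong₂ _∷_ (sym (Anyₚ.lookup-index (ys⊆ (here refl)))) eq

module _ {A : Set} where

  -- The last part takes the whole remainder, so the parts recover the list exactly. This needs
  -- `p ≥ 1`, which is why the entries of `η` have to be positive.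
  chunk : ∀ p → ℕ → List A → Vec (List A) p
  chunk zero s xs = []
  chunk (suc zero) s xs = xs ∷ []
  chunk (suc (suc p)) s xs = take s xs ∷ chunk (suc p) s (drop s xs)

  concat-chunk : ∀ p {s} xs → 1 ≤ p → concat (Vec.toList (chunk p s xs)) ≡ xs
  concat-chunk (suc zero) xs _ = Listₚ.++-identityʳ xs
  concat-chunk (suc (suc p)) {s} xs _ =
    trans (cong (take s xs ++_) (concat-chunk (suc p) (drop s xs) (s≤s z≤n))) (Listₚ.take++drop≡id s xs)

  chunk-size : ∀ p {s} xs → p * s ≤ length xs → All (λ P → s ≤ length P) (chunk p s xs)
  chunk-size zero xs h = []
  chunk-size (suc zero) {s} xs h = ℕₚ.≤-trans (ℕₚ.m≤m+n s 0) h ∷ []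
  chunk-size (suc (suc p)) {s} xs h = ℕₚ.≤-reflexive (sym (length-take-≤ (ℕₚ.m+n≤o⇒m≤o s h))) ∷
    chunk-size (suc p) (drop s xs) (subst (suc p * s ≤_) (sym (Listₚ.length-drop s xs))
      (ℕₚ.m+n≤o⇒m≤o∸n (suc p * s) (subst (_≤ length xs) (ℕₚ.+-comm s (suc p * s)) h)))

  AllPairs-concat⁻ : ∀ {R : A → A → Set} xss → AllPairs R (concat xss) →
    AllPairs (λ xs ys → ∀ {x y} → x ∈ xs → y ∈ ys → R x y) xss
  AllPairs-concat⁻ [] ps = []
  AllPairs-concat⁻ (xs ∷ xss) ps with AllPairs-++⁻ xs ps
  ... | _ , ps′ , h = Allᴸ.tabulate (λ ys∈ x∈ y∈ → h x∈ (∈ₚ.∈-concat⁺′ y∈ ys∈)) ∷ AllPairs-concat⁻ xss ps′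

  All-concat⁻ : ∀ {R : A → A → Set} xss → AllPairs R (concat xss) → Allᴸ (AllPairs R) xss
  All-concat⁻ [] ps = []
  All-concat⁻ (xs ∷ xss) ps with AllPairs-++⁻ xs ps
  ... | p , ps′ , _ = p ∷ All-concat⁻ xss ps′

-- m-sequences

module MSequence (T : Tournament) where
  open Sparse (E T) using (Block; IsBlock; Before; FewBack)

  Vertices = List (Fin (size T))

  -- Surplus blocks are dropped, since more blocks than entries of `v` are built. Here `v` finally
  -- decides between the large set and the chain of each block.
  mkSeq : ℕ → ∀ v η (bs : List Block) → length v ≤ length bs → Seq (size T) v η
  mkSeq s [] [] bs _ = []
  mkSeq s (false ∷ v) η ((B , P) ∷ bs) (s≤s h) = big (fromList B) (mkSeq s v η bs h)
  mkSeq s (true ∷ v) (p ∷ η) ((B , P) ∷ bs) (s≤s h) =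
    trs (Vec.map fromList (chunk p s P)) (mkSeq s v η bs h)

  pick : List Bool → List Block → List Vertices
  pick [] _ = []
  pick (_ ∷ _) [] = []
  pick (false ∷ v) ((B , P) ∷ bs) = B ∷ pick v bs
  pick (true ∷ v) ((B , P) ∷ bs) = P ∷ pick v bs

  ⋃-chunk : ∀ p s P → 1 ≤ p → ⋃ (Vec.toList (Vec.map (fromList {size T}) (chunk p s P))) ≡ fromList P
  ⋃-chunk p s P 1≤p = trans (cong ⋃ (Vecₚ.toList-map fromList (chunk p s P)))
    (trans (⋃-fromList (Vec.toList (chunk p s P))) (cong fromList (concat-chunk p P 1≤p)))

  blocks-mkSeq : ∀ {s} v η bs h → All (1 ≤_) η → blocks (mkSeq s v η bs h) ≡ map fromList (pick v bs)
  blocks-mkSeq [] [] bs h _ = refl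
  blocks-mkSeq (false ∷ v) η ((B , P) ∷ bs) (s≤s h) pos = cong (fromList B ∷_) (blocks-mkSeq v η bs h pos)
  blocks-mkSeq {s} (true ∷ v) (p ∷ η) ((B , P) ∷ bs) (s≤s h) (1≤p ∷ pos) =
    cong₂ _∷_ (⋃-chunk p s P 1≤p) (blocks-mkSeq v η bs h pos)

  record Separated (r : ℕ) (X Y : Vertices) : Set where
    constructor separated
    field
      unique₁ : Unique X
      unique₂ : Unique Y
      nonempty₁ : 1 ≤ length X
      nonempty₂ : 1 ≤ length Y
      apart : Apart X Y
      fewBack : FewBack r X Y

  pick-All : ∀ {Q : Vertices → Set} v bs → Allᴸ (λ β → Q (proj₁ β) × Q (proj₂ β)) bs → Allᴸ Q (pick v bs)
  pick-All [] bs qs = []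
  pick-All (_ ∷ _) [] qs = []
  pick-All (false ∷ v) (_ ∷ bs) ((q , _) ∷ qs) = q ∷ pick-All v bs qs
  pick-All (true ∷ v) (_ ∷ bs) ((_ , q) ∷ qs) = q ∷ pick-All v bs qs

  module _ {M L r : ℕ} {X : Vertices} (1≤M : 1 ≤ M) (1≤L : 1 ≤ L) where

    pick-separated : ∀ v bs → Allᴸ (IsBlock M L X) bs → AllPairs (Before r) bs → AllPairs (Separated r) (pick v bs)
    pick-separated [] bs _ _ = []
    pick-separated (_ ∷ _) [] _ _ = []
    pick-separated (b ∷ v) ((B , P) ∷ bs) ((uB , lB , _ , ch , lP , P⊆) ∷ oks) (befores ∷ ps) = head b
      where
      bigB : ∀ (Z : Vertices) → length Z ≡ 2 * M → 1 ≤ length Z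
      bigB Z eq = subst (1 ≤_) (sym eq) (ℕₚ.≤-trans 1≤M (ℕₚ.m≤m+n M _))
      rest = pick-separated v bs oks ps
      fromB : ∀ {β} → IsBlock M L X β × Before r (B , P) β → Separated r B (proj₁ β) × Separated r B (proj₂ β)
      fromB {β} ((u , l , _ , c , lP′ , P′⊆) , (ap , f₁ , f₂ , f₃ , f₄)) =
        separated uB u (bigB B lB) (bigB (proj₁ β) l) ap f₁ ,
        separated uB (Chain⇒Unique T c) (bigB B lB) (ℕₚ.≤-trans 1≤L lP′) (λ x∈ y∈ → ap x∈ (P′⊆ y∈)) f₂
      fromP : ∀ {β} → IsBlock M L X β × Before r (B , P) β → Separated r P (proj₁ β) × Separated r P (proj₂ β)
      fromP {β} ((u , l , _ , c , lP′ , P′⊆) , (ap , f₁ , f₂ , f₃ , f₄)) =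
        separated (Chain⇒Unique T ch) u (ℕₚ.≤-trans 1≤L lP) (bigB (proj₁ β) l) (λ x∈ y∈ → ap (P⊆ x∈) y∈) f₃ ,
        separated (Chain⇒Unique T ch) (Chain⇒Unique T c) (ℕₚ.≤-trans 1≤L lP) (ℕₚ.≤-trans 1≤L lP′)
          (λ x∈ y∈ → ap (P⊆ x∈) (P′⊆ y∈)) f₄
      head : ∀ b → AllPairs (Separated r) (pick (b ∷ v) ((B , P) ∷ bs))
      head false = pick-All v bs (Allᴸ.map fromB (Allᴸ.zip (oks , befores))) ∷ rest
      head true = pick-All v bs (Allᴸ.map fromP (Allᴸ.zip (oks , befores))) ∷ rest

  fromList-disjoint : ∀ {X Y : Vertices} → Apart X Y → Disjoint (fromList X) (fromList Y)
  fromList-disjoint {X} {Y} ap (x , x∈) with Subsetₚ.x∈p∩q⁻ (fromList X) (fromList Y) x∈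
  ... | x∈X , x∈Y = ap (∈-fromList⁻ x∈X) (∈-fromList⁻ x∈Y)

  fromList-nonempty : ∀ (X : Vertices) → 1 ≤ length X → Subset.Nonempty (fromList X)
  fromList-nonempty (x ∷ X) _ = x , ∈-fromList⁺ {xs = x ∷ X} (here refl)

  -- Forward and backward edges together number `a`; with at most `a / (k + 1)` of them backward, at
  -- least `k a / (k + 1)` are forward.
  separated⇒density : ∀ {k X Y} → Separated (suc k) X Y → DensityAtLeast T (1ℚ - unit k) (fromList X) (fromList Y)
  separated⇒density {k} {X} {Y} (separated uX uY neX neY ap few) =
    fromList-nonempty X neX , fromList-nonempty Y neY , density-≤ k (subst₂ (λ a e → k * a ≤ suc k * e)
      (sym (cong₂ _*_ (∣fromList∣ uX) (∣fromList∣ uY))) (sym (edges-fromList T uX uY))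
      (ℕₚ.+-cancelˡ-≤ a _ _ (begin
        suc k * a ≡⟨ cong (suc k *_) (edges-complement T ap) ⟨
        suc k * (e + b) ≡⟨ ℕₚ.*-distribˡ-+ (suc k) e b ⟩
        suc k * e + suc k * b ≤⟨ ℕₚ.+-monoʳ-≤ (suc k * e) few ⟩
        suc k * e + a ≡⟨ ℕₚ.+-comm (suc k * e) a ⟩
        a + suc k * e ∎)))
    where
    open ℕₚ.≤-Reasoning
    a = length X * length Y
    e = ∑ (λ x → count (E T x) Y) X
    b = ∑ (λ x → count (λ y → E T y x) Y) X

  mkSeq-OK : ∀ {t c k M L s X λ′} → size T ≤ suc k * (2 * M) → t ≤ suc k * s → c ≡ unit k →
    ∀ v η bs h → All (1 ≤_) η → All (λ p → p * s ≤ L) η → Allᴸ (IsBlock M L X) bs →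
    BlocksOK T t c λ′ (mkSeq s v η bs h)
  mkSeq-OK nM ts refl [] [] bs h _ _ _ = tt
  mkSeq-OK {k = k} {M = M} {λ′ = λ′} nM ts refl (false ∷ v) η ((B , P) ∷ bs) (s≤s h) pos small ((uB , lB , _) ∷ oks) =
    unit-≤⁺ k (subst (λ z → size T ≤ suc k * z) (sym (trans (∣fromList∣ uB) lB)) nM) ,
    mkSeq-OK {M = M} {λ′ = λ′} nM ts refl v η bs h pos small oks
  mkSeq-OK {t} {k = k} {M = M} {s = s} {λ′ = λ′} nM ts refl (true ∷ v) (p ∷ η) ((B , P) ∷ bs) (s≤s h) (1≤p ∷ pos) (ps≤L ∷ small)
      ((_ , _ , _ , ch , L≤ , _) ∷ oks) =
    subst (TransitiveSet T) (sym (⋃-chunk p s P 1≤p)) (chain⇒transitive T ch) ,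
    subst (AllPairs Disjoint) (sym tl) (AllPairsₚ.map⁺ (AllPairs.map (λ h → fromList-disjoint λ x∈ y∈ → asym T (h x∈ y∈) (h x∈ y∈)) complete)) ,
    subst (AllPairs (CompleteTo T)) (sym tl) (AllPairsₚ.map⁺ (AllPairs.map (λ h a b a∈ b∈ → h (∈-fromList⁻ a∈) (∈-fromList⁻ b∈)) complete)) ,
    sizes (chunk p s P) parts-unique (chunk-size p P (ℕₚ.≤-trans ps≤L L≤)) ,
    mkSeq-OK {M = M} {λ′ = λ′} nM ts refl v η bs h pos small oks
    where
    tl = Vecₚ.toList-map (fromList {size T}) (chunk p s P)
    complete : AllPairs (λ xs ys → ∀ {x y} → x ∈ xs → y ∈ ys → E T x y ≡ true) (Vec.toList (chunk p s P))
    complete = AllPairs-concat⁻ _ (subst (Chain T) (sym (concat-chunk p P 1≤p)) ch)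
    parts-unique : Allᴸ Unique (Vec.toList (chunk p s P))
    parts-unique = All-concat⁻ _ (subst Unique (sym (concat-chunk p P 1≤p)) (Chain⇒Unique T ch))
    sizes : ∀ {p} (qs : Vec Vertices p) → Allᴸ Unique (Vec.toList qs) → All (λ P → s ≤ length P) qs →
      All (λ P → unit k ℚ.* ℕ→ℚ t ℚ.≤ ℕ→ℚ ∣ P ∣) (Vec.map fromList qs)
    sizes [] _ _ = []
    sizes (Q ∷ qs) (u ∷ us) (s≤ ∷ ss) = unit-≤⁺ k (ℕₚ.≤-trans ts (ℕₚ.*-monoʳ-≤ (suc k) (subst (s ≤_) (sym (∣fromList∣ u)) s≤))) ∷ sizes qs us ss

-- The m-sequence and restriction to the union of its blocks

module _ (T : Tournament) where
  open Sparse (E T) using (Block; IsBlock; Before)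
  open MSequence T

  -- The index `suc κ` makes `λ` equal to `1/(κ + 2)`, hence less than 1, and matches the sparsity
  -- `suc (suc κ)` of the blocks.
  mkSeq-isMSeq : ∀ {t k κ M L s X} v η bs h → 1 ≤ M → 1 ≤ L → size T ≤ suc k * (2 * M) → t ≤ suc k * s →
    All (1 ≤_) η → All (λ p → p * s ≤ L) η → Allᴸ (IsBlock M L X) bs →
    AllPairs (Before (suc (suc κ))) bs → IsMSeq T t (unit k) (unit (suc κ)) (mkSeq s v η bs h)
  mkSeq-isMSeq {k = k} {κ} {M} v η bs h 1≤M 1≤L nM ts pos small oks befores =
    unit>0 k , ℚₚ.<⇒≤ (unit>0 (suc κ)) , unit<1 κ ,
    subst (AllPairs Disjoint) (sym eq) (AllPairsₚ.map⁺ (AllPairs.map (λ s → fromList-disjoint (Separated.apart s)) seps)) ,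
    mkSeq-OK {M = M} {λ′ = unit (suc κ)} nM ts refl v η bs h pos small oks ,
    subst (AllPairs (DensityAtLeast T (1ℚ - unit (suc κ)))) (sym eq) (AllPairsₚ.map⁺ (AllPairs.map (separated⇒density {suc κ}) seps))
    where
    eq = blocks-mkSeq v η bs h pos
    seps : AllPairs (Separated (suc (suc κ))) (pick v bs)
    seps = pick-separated 1≤M 1≤L v bs oks befores

  module _ (xs : List (Fin (size T))) (u : Unique xs) where
    private
      T′ = induced T xs u
      f = lookup xs
    module S′ = Sparse (E T′)

    mapBlock : S′.Block → Block
    mapBlock (B , P) = map f B , map f P

    lift-blocks : ∀ {bs} → Allᴸ (λ β → proj₁ β ⊆ xs × proj₂ β ⊆ xs) bs → ∃ λ bs′ → map mapBlock bs′ ≡ bs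
    lift-blocks [] = [] , refl
    lift-blocks ((B⊆ , P⊆) ∷ h) with lift-⊆ B⊆ | lift-⊆ P⊆ | lift-blocks h
    ... | B , refl | P , refl | bs , refl = (B , P) ∷ bs , refl

    induced-IsBlock : ∀ {M L X β} → IsBlock M L X (mapBlock β) → S′.IsBlock M L (allFin (length xs)) β
    induced-IsBlock {L = L} {β = B , P} (uB , lB , _ , ch , lP , P⊆) =
      Uniqueₚ.map⁻ uB , trans (sym (Listₚ.length-map f B)) lB , (λ _ → ∈ₚ.∈-allFin _) ,
      AllPairsₚ.map⁻ ch , subst (L ≤_) (Listₚ.length-map f P) lP , sub
      where
      sub : P ⊆ B
      sub x∈ with ∈ₚ.∈-map⁻ f (P⊆ (∈ₚ.∈-map⁺ f x∈))
      ... | y , y∈ , eq = subst (_∈ B) (sym (lookup-injective u _ _ eq)) y∈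

    induced-FewBack : ∀ {r} X Y → Sparse.FewBack (E T) r (map f X) (map f Y) → S′.FewBack r X Y
    induced-FewBack {r} X Y = subst₂ _≤_
      (cong (r *_) (trans (∑-map _ f X) (∑-cong X (λ _ → ∑-map _ f Y))))
      (cong₂ _*_ (Listₚ.length-map f X) (Listₚ.length-map f Y))

    induced-Before : ∀ {r β β′} → Before r (mapBlock β) (mapBlock β′) → S′.Before r β β′
    induced-Before {r} {B , P} {B′ , P′} (ap , f₁ , f₂ , f₃ , f₄) =
      (λ x∈ y∈ → ap (∈ₚ.∈-map⁺ f x∈) (∈ₚ.∈-map⁺ f y∈)) ,
      induced-FewBack {r} B B′ f₁ , induced-FewBack {r} B P′ f₂ ,
      induced-FewBack {r} P B′ f₃ , induced-FewBack {r} P P′ f₄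

  length-concat-blocks : ∀ {M L X} bs → Allᴸ (IsBlock M L X) bs → length (concat (map proj₁ bs)) ≡ length bs * (2 * M)
  length-concat-blocks [] [] = refl
  length-concat-blocks {M} {L} {X} ((B , _) ∷ bs) ((_ , lB , _) ∷ oks) =
    trans (Listₚ.length-++ B) (cong₂ _+_ lB (length-concat-blocks {M} {L} {X} bs oks))

  unique-concat-blocks : ∀ {M L X r bs} → Allᴸ (IsBlock M L X) bs → AllPairs (Before r) bs → Unique (concat (map proj₁ bs))
  unique-concat-blocks oks befores = Uniqueₚ.concat⁺ (Allₚ.map⁺ (Allᴸ.map proj₁ oks))
    (AllPairsₚ.map⁺ (AllPairs.map (λ { (ap , _) (x∈ , y∈) → ap x∈ y∈ }) befores))

  blocks-inside-union : ∀ {M L X} bs → Allᴸ (IsBlock M L X) bs →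
    Allᴸ (λ β → proj₁ β ⊆ concat (map proj₁ bs) × proj₂ β ⊆ concat (map proj₁ bs)) bs
  blocks-inside-union bs oks = Allᴸ.tabulate λ {β} β∈ →
    inside {β} β∈ (proj₂ (proj₂ (proj₂ (proj₂ (proj₂ (Allᴸ.lookup oks β∈))))))
    where
    inside : ∀ {β} → β ∈ bs → proj₂ β ⊆ proj₁ β → proj₁ β ⊆ concat (map proj₁ bs) × proj₂ β ⊆ concat (map proj₁ bs)
    inside {B , P} β∈ P⊆B = B⊆ , λ x∈ → B⊆ (P⊆B x∈)
      where
      B⊆ : B ⊆ concat (map proj₁ bs)
      B⊆ x∈ = ∈ₚ.∈-concat⁺′ x∈ (∈ₚ.∈-map⁺ proj₁ β∈)

  record Restriction (r k M L : ℕ) : Set where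
    constructor restriction
    field
      {union} : List (Fin (size T))
      unique : Unique union
      length-union : length union ≡ k * (2 * M)
      blocks′ : List (Sparse.Block (E (induced T union unique)))
      length-blocks : length blocks′ ≡ k
      areBlocks : Allᴸ (Sparse.IsBlock (E (induced T union unique)) M L (allFin (length union))) blocks′
      inOrder : AllPairs (Sparse.Before (E (induced T union unique)) r) blocks′

  restrict : ∀ {M L X r} bs → Allᴸ (IsBlock M L X) bs → AllPairs (Before r) bs → Restriction r (length bs) M L
  restrict {M} {L} {X} {r} bs oks befores = from-lift (lift-blocks Y u (blocks-inside-union {M} {L} {X} bs oks))
    where
    Y = concat (map proj₁ bs)
    u : Unique Y
    u = unique-concat-blocks {M} {L} {X} {r} {bs} oks befores
    from-lift : (∃ λ bs′ → map (mapBlock Y u) bs′ ≡ bs) → Restriction r (length bs) M L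
    from-lift (bs′ , eq) = restriction u (length-concat-blocks {M} {L} {X} bs oks) bs′
      (trans (sym (Listₚ.length-map (mapBlock Y u) bs′)) (cong length eq))
      (Allᴸ.map (λ {β} → induced-IsBlock Y u {M} {L} {X} {β}) (Allₚ.map⁻ (subst (Allᴸ (IsBlock M L X)) (sym eq) oks)))
      (AllPairs.map (λ {β} {β′} → induced-Before Y u {r} {β} {β′}) (AllPairsₚ.map⁻ (subst (AllPairs (Before r)) (sym eq) befores)))

fromList-elems : ∀ {n} (p : Subset n) → fromList (elems p) ≡ p
fromList-elems p = Subsetₚ.⊆-antisym (λ x∈ → ∈-elems⁻ p (∈-fromList⁻ x∈)) (λ x∈ → ∈-fromList⁺ (∈-elems⁺ p x∈))
  where
  ∈-elems⁺ : ∀ {n} (p : Subset n) {x} → x Subset.∈ p → x ∈ elems p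
  ∈-elems⁺ (true ∷ p) Vec.here = here refl
  ∈-elems⁺ (true ∷ p) (Vec.there x∈) = there (∈ₚ.∈-map⁺ suc (∈-elems⁺ p x∈))
  ∈-elems⁺ (false ∷ p) (Vec.there x∈) = ∈ₚ.∈-map⁺ suc (∈-elems⁺ p x∈)

-- Forward and backward edges between disjoint sets number `|A| |B|` in total, so density one leaves
-- no backward edge.
densityOne⇒complete : ∀ T {A B} → Disjoint A B → DensityOne T A B → CompleteTo T A B
densityOne⇒complete T {A} {B} dis (_ , _ , eq) a b a∈ b∈ =
  complete-list T {elems A} {elems B} (λ x∈ y∈ → dis (_ , Subsetₚ.x∈p∩q⁺ (∈-elems⁻ A x∈ , ∈-elems⁻ B y∈)))
    (trans (sym (edges-fromList T (elems-unique A) (elems-unique B)))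
      (trans (cong₂ (edges T) (fromList-elems A) (fromList-elems B))
        (trans eq (sym (cong₂ _*_ (length-elems A) (length-elems B))))))
    (∈-fromList⁻ (subst (a Subset.∈_) (sym (fromList-elems A)) a∈))
    (∈-fromList⁻ (subst (b Subset.∈_) (sym (fromList-elems B)) b∈))

-- The minimal counterexample

-- Bernoulli's inequality `(1 + 1/s)^q ≥ 1 + q/s` with denominators cleared.
bernoulli : ∀ s q → (s + q) * s ^ q ≤ s * suc s ^ q
bernoulli s zero = ℕₚ.≤-reflexive (cong (_* 1) (ℕₚ.+-identityʳ s))
bernoulli s (suc q) = begin
  (s + suc q) * (s * s ^ q)       ≤⟨ ℕₚ.m≤m+n _ (q * s ^ q) ⟩
  (s + suc q) * (s * s ^ q) + q * s ^ q ≡⟨ solve 3 (λ s q p → (s :+ (con 1 :+ q)) :* (s :* p) :+ q :* p := (con 1 :+ s) :* ((s :+ q) :* p)) refl s q (s ^ q) ⟩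
  suc s * ((s + q) * s ^ q)       ≤⟨ ℕₚ.*-monoʳ-≤ (suc s) (bernoulli s q) ⟩
  suc s * (s * suc s ^ q)         ≡⟨ solve 2 (λ s p → (con 1 :+ s) :* (s :* p) := s :* ((con 1 :+ s) :* p)) refl s (suc s ^ q) ⟩
  s * (suc s * suc s ^ q)         ∎
  where
  open ℕₚ.≤-Reasoning
  open +-*-Solver

-- With `c = 1/(s + 1)` this reads `(1 - c)^q ≤ c`; for `q ≥ s²` the Bernoulli bound `1 + q/s` is at
-- least `1 + s`.
power-gap : ∀ {s q} → 1 ≤ s → s * s ≤ q → suc s * s ^ q ≤ suc s ^ q
power-gap {s} {q} 1≤s ss≤q = ℕₚ.*-cancelˡ-≤ s {{>-nonZero 1≤s}} (begin
  s * (suc s * s ^ q) ≡⟨ ℕₚ.*-assoc s (suc s) (s ^ q) ⟨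
  s * suc s * s ^ q ≡⟨ cong (_* s ^ q) (ℕₚ.*-suc s s) ⟩
  (s + s * s) * s ^ q ≤⟨ ℕₚ.*-monoˡ-≤ (s ^ q) (ℕₚ.+-monoʳ-≤ s ss≤q) ⟩
  (s + q) * s ^ q ≤⟨ bernoulli s q ⟩
  s * suc s ^ q ∎)
  where open ℕₚ.≤-Reasoning

n<2^n : ∀ n → n < 2 ^ n
n<2^n zero = s≤s z≤n
n<2^n (suc n) = begin
  suc (suc n) ≤⟨ s≤s (n<2^n n) ⟩
  1 + 2 ^ n ≤⟨ ℕₚ.+-monoˡ-≤ (2 ^ n) (ℕₚ.m^n>0 2 n) ⟩
  2 ^ n + 2 ^ n ≡⟨ cong (2 ^ n +_) (ℕₚ.+-identityʳ _) ⟨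
  2 * 2 ^ n ∎
  where open ℕₚ.≤-Reasoning

^-distribʳ-* : ∀ k m n → (m * n) ^ k ≡ m ^ k * n ^ k
^-distribʳ-* zero m n = refl
^-distribʳ-* (suc k) m n = trans (cong (m * n *_) (^-distribʳ-* k m n))
  (solve 4 (λ m n a b → m :* n :* (a :* b) := m :* a :* (n :* b)) refl m n (m ^ k) (n ^ k))
  where open +-*-Solver

module _ {q t N R : ℕ} (t^q<N : t ^ q < N) where

  -- A set of at least `N / R` vertices has `a^q ≥ N / R > (t / 2)^q`.
  half-bound : ∀ {a x} → R ≤ 2 ^ q → N ≤ R * x → x ≤ a ^ q → ¬ (2 * a ≤ t)
  half-bound {a} {x} R≤ N≤ x≤ 2a≤t = ℕₚ.<-irrefl refl (begin-strict
    t ^ q <⟨ t^q<N ⟩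
    N ≤⟨ N≤ ⟩
    R * x ≤⟨ ℕₚ.*-mono-≤ R≤ x≤ ⟩
    2 ^ q * a ^ q ≡⟨ ^-distribʳ-* q 2 a ⟨
    (2 * a) ^ q ≤⟨ ℕₚ.^-monoˡ-≤ q 2a≤t ⟩
    t ^ q ∎)
    where open ℕₚ.≤-Reasoning

  -- If `a + b ≤ t`, the smaller of the two is at most `t / 2`.
  two-sets : ∀ {a b x y} → R ≤ 2 ^ q → N ≤ R * x → x ≤ a ^ q → N ≤ R * y → y ≤ b ^ q → ¬ (a + b ≤ t)
  two-sets {a} {b} R≤ N≤x x≤ N≤y y≤ a+b≤t with ℕₚ.≤-total a b
  ... | inj₁ a≤b = half-bound R≤ N≤x x≤ (ℕₚ.≤-trans (ℕₚ.+-monoʳ-≤ a (ℕₚ.≤-trans (ℕₚ.≤-reflexive (ℕₚ.+-identityʳ a)) a≤b)) a+b≤t)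
  ... | inj₂ b≤a = half-bound R≤ N≤y y≤ (ℕₚ.≤-trans (ℕₚ.+-mono-≤ b≤a (ℕₚ.≤-reflexive (ℕₚ.+-identityʳ b))) a+b≤t)

-- Put `c = 1/(s + 1)`. From `b ≥ c t` follows `a ≤ (1 - c) t`, so
-- `N ≤ a^q / c ≤ (1 - c)^q t^q / c`, which `power-gap` bounds by `t^q`.
set-and-transitive : ∀ {q t N s a b x} → t ^ q < N → 1 ≤ s → s * s ≤ q →
  N ≤ suc s * x → x ≤ a ^ q → t ≤ suc s * b → ¬ (a + b ≤ t)
set-and-transitive {q} {t} {N} {s} {a} {b} {x} t^q<N 1≤s ss≤q N≤ x≤ t≤ a+b≤t = ℕₚ.<⇒≱ t^q<N
  (ℕₚ.*-cancelˡ-≤ (suc s * s ^ q) {{>-nonZero positive}} (begin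
    suc s * s ^ q * N ≤⟨ ℕₚ.*-mono-≤ (power-gap 1≤s ss≤q) (ℕₚ.≤-trans N≤ (ℕₚ.*-monoʳ-≤ (suc s) x≤)) ⟩
    suc s ^ q * (suc s * a ^ q) ≡⟨ solve 3 (λ p c z → p :* (c :* z) := c :* (p :* z)) refl (suc s ^ q) (suc s) (a ^ q) ⟩
    suc s * (suc s ^ q * a ^ q) ≡⟨ cong (suc s *_) (^-distribʳ-* q (suc s) a) ⟨
    suc s * (suc s * a) ^ q ≤⟨ ℕₚ.*-monoʳ-≤ (suc s) (ℕₚ.^-monoˡ-≤ q shrink) ⟩
    suc s * (s * t) ^ q ≡⟨ cong (suc s *_) (^-distribʳ-* q s t) ⟩
    suc s * (s ^ q * t ^ q) ≡⟨ ℕₚ.*-assoc (suc s) (s ^ q) _ ⟨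
    suc s * s ^ q * t ^ q ∎))
  where
  open ℕₚ.≤-Reasoning
  open +-*-Solver
  positive : 0 < suc s * s ^ q
  positive = ℕₚ.≤-trans (ℕₚ.m^n>0 s {{>-nonZero 1≤s}} q) (ℕₚ.m≤m+n _ _)
  shrink : suc s * a ≤ s * t
  shrink = ℕₚ.+-cancelˡ-≤ t _ _ (begin
    t + suc s * a ≤⟨ ℕₚ.+-monoˡ-≤ _ t≤ ⟩
    suc s * b + suc s * a ≡⟨ ℕₚ.*-distribˡ-+ (suc s) b a ⟨
    suc s * (b + a) ≤⟨ ℕₚ.*-monoʳ-≤ (suc s) (subst (_≤ t) (ℕₚ.+-comm a b) a+b≤t) ⟩
    suc s * t ∎)

Contains-trans : ∀ {A B C} → Contains A B → Contains B C → Contains A C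
Contains-trans (x , x-inj , x-iso) (y , y-inj , y-iso) =
  x ∘ y , y-inj ∘ x-inj , λ a b → trans (x-iso (y a) (y b)) (y-iso a b)

Disjoint-sym : ∀ {n} {A B : Subset n} → Disjoint A B → Disjoint B A
Disjoint-sym {A = A} {B} dis (x , x∈) = dis (x , subst (x Subset.∈_) (Subsetₚ.∩-comm B A) x∈)

opaque
  -- Since `d ≤ n`, the remainder is at most `d * x`, so rounding down costs at most a factor 2.
  quotient : ∀ {n d} → 1 ≤ d → d ≤ n → ∃ λ x → 1 ≤ x × d * x ≤ n × n ≤ 2 * (d * x)
  quotient {n} {d} 1≤d d≤n = n / d , 1≤x , subst (_≤ n) (ℕₚ.*-comm (n / d) d) (DivModₚ.m/n*n≤m n d) , (begin
    n ≡⟨ DivModₚ.m≡m%n+[m/n]*n n d ⟩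
    n % d + n / d * d ≤⟨ ℕₚ.+-mono-≤ (ℕₚ.<⇒≤ (DivModₚ.m%n<n n d)) (ℕₚ.≤-reflexive (ℕₚ.*-comm (n / d) d)) ⟩
    d + d * (n / d) ≤⟨ ℕₚ.+-monoˡ-≤ (d * (n / d)) (subst (_≤ d * (n / d)) (ℕₚ.*-identityʳ d) (ℕₚ.*-monoʳ-≤ d 1≤x)) ⟩
    d * (n / d) + d * (n / d) ≡⟨ cong (d * (n / d) +_) (ℕₚ.+-identityʳ _) ⟨
    2 * (d * (n / d)) ∎)
    where
    open ℕₚ.≤-Reasoning
    instance
      d≢0 : NonZero d
      d≢0 = >-nonZero 1≤d
    1≤x : 1 ≤ n / d
    1≤x = DivModₚ.m≥n⇒m/n>0 d≤n

  even-quotient : ∀ {t g} → 1 ≤ g → 2 * g ≤ t → ∃ λ s → 1 ≤ s × 2 * (g * s) ≤ t × t ≤ 4 * (g * s)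
  even-quotient {t} {g} 1≤g 2g≤t with quotient {t} {2 * g} (ℕₚ.≤-trans 1≤g (ℕₚ.m≤m+n g _)) 2g≤t
  ... | s , 1≤s , lower , upper = s , 1≤s , subst (_≤ t) (ℕₚ.*-assoc 2 g s) lower ,
    subst (t ≤_) (trans (cong (2 *_) (ℕₚ.*-assoc 2 g s)) (sym (ℕₚ.*-assoc 2 2 (g * s)))) upper

-- Here `ℓ` is the number of blocks and `g` exceeds the total number of parts, so a chain of length
-- `g * s` can be cut into parts of size `s` for every entry of `η`. Further, `c₁ = 1/(k₁ + 1)`,
-- `λ = 1/(κ + 2)`, `c₂ ≥ 1/(k₂ + 1)`, `M` is about `N / D`, and `1/(σ + 1)` is the fraction
-- guaranteed for the sets of a strong pair. The strict bound `length v < ℓ` provides a block even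
-- when `v` is empty.
module Step
  {m : ℕ} (Hs : Fin m → Tournament) (i₀ : Fin m) (v : List Bool) (η : Vec ℕ (ones v))
  (pos : All (1 ≤_) η) (ℓ g k₁ κ k₂ D σ q : ℕ) (c₂ : ℚ)
  (v<ℓ : length v < ℓ) (η<g : Vec.sum η < g) (k₁≥ : ℓ + 4 * g ≤ suc k₁)
  (c₂≥ : unit k₂ ℚ.≤ c₂)
  (D≥ : 2 + blockFactor (size (Hs i₀)) (suc (suc κ)) ℓ ≤ D)
  (σ≥ : D * suc k₂ + (2 * D + 4 * suc k₂) ≤ suc σ) (1≤σ : 1 ≤ σ)
  (σσ≤q : σ * σ ≤ q) (R≤2^q : suc σ ≤ 2 ^ q) (N₀≤2^q : D + 2 ^ (2 * g) ≤ 2 ^ q)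
  (seh : ∀ T t → IsTr T t → ∀ (χ : Seq (size T) v η) → IsMSeq T t (unit k₁) (unit (suc κ)) χ →
    (∃ λ i → Contains T (Hs i)) ⊎ StrongPair T t c₂ χ)
  (T : Tournament) (free : ∀ i → ¬ Contains T (Hs i))
  (ih : ∀ Y → Unique Y → length Y < size T → ∃ λ P → Chain T P × P ⊆ Y × length Y ≤ length P ^ q)
  {t : ℕ} (isTr : IsTr T t) (t^q<N : t ^ q < size T)
  where

  N = size T
  H₀ = Hs i₀
  V = allFin N

  |V| : length V ≡ N
  |V| = Listₚ.length-tabulate (λ i → i)

  chain-in-V : ∀ k → 2 ^ k ≤ N → suc k ≤ t
  chain-in-V k h with ramsey T k V (Uniqueₚ.allFin⁺ N) (subst (2 ^ k ≤_) (sym |V|) h)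
  ... | P , ch , len , _ = ℕₚ.≤-trans len (chain-≤ T isTr ch)

  1≤t : 1 ≤ t
  1≤t = chain-in-V 0 (ℕₚ.≤-trans (s≤s z≤n) t^q<N)

  2≤t : 2 ≤ t
  2≤t = chain-in-V 1 (ℕₚ.≤-trans (s≤s (ℕₚ.m^n>0 t {{>-nonZero 1≤t}} q)) t^q<N)

  -- A counterexample is large by itself: `t ≥ 2` and `t^q < N` give `N > 2^q`. The summand `D`
  -- permits division by `D`, and `2 ^ (2 * g)` yields `t ≥ 2 * g` through `ramsey`.
  N₀≤N : D + 2 ^ (2 * g) ≤ N
  N₀≤N = ℕₚ.≤-trans N₀≤2^q (ℕₚ.≤-trans (ℕₚ.^-monoˡ-≤ q 2≤t) (ℕₚ.<⇒≤ t^q<N))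

  2g≤t : 2 * g ≤ t
  2g≤t = ℕₚ.<⇒≤ (chain-in-V (2 * g) (ℕₚ.≤-trans (ℕₚ.m≤n+m _ D) N₀≤N))

  2≤D : 2 ≤ D
  2≤D = ℕₚ.≤-trans (ℕₚ.m≤m+n 2 _) D≥

  1≤ℓ : 1 ≤ ℓ
  1≤ℓ = ℕₚ.≤-trans (s≤s z≤n) v<ℓ

  1≤g : 1 ≤ g
  1≤g = ℕₚ.≤-trans (s≤s z≤n) η<g

  block-scale : ∃ λ M → 1 ≤ M × D * M ≤ N × N ≤ 2 * (D * M)
  block-scale = quotient (ℕₚ.<⇒≤ 2≤D) (ℕₚ.≤-trans (ℕₚ.m≤m+n D _) N₀≤N)

  M = proj₁ block-scale
  1≤M = proj₁ (proj₂ block-scale)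
  DM≤N = proj₁ (proj₂ (proj₂ block-scale))
  N≤2DM = proj₂ (proj₂ (proj₂ block-scale))

  M<N : M < N
  M<N = ℕₚ.<-≤-trans (ℕₚ.m<m+n M 1≤M) (ℕₚ.≤-trans
    (ℕₚ.≤-trans (ℕₚ.≤-reflexive (cong (M +_) (sym (ℕₚ.+-identityʳ M)))) (ℕₚ.*-monoˡ-≤ M 2≤D)) DM≤N)

  part-scale : ∃ λ s → 1 ≤ s × 2 * (g * s) ≤ t × t ≤ 4 * (g * s)
  part-scale = even-quotient 1≤g 2g≤t

  s = proj₁ part-scale
  1≤s = proj₁ (proj₂ part-scale)
  2gs≤t = proj₁ (proj₂ (proj₂ part-scale))
  t≤4gs = proj₂ (proj₂ (proj₂ part-scale))

  L = g * s

  1≤L : 1 ≤ L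
  1≤L = ℕₚ.*-mono-≤ 1≤g 1≤s

  -- A set of `M` vertices has fewer than `N` but at least `N / (2 D)` of them, so minimality and
  -- `half-bound` give a chain longer than `t / 2`, which is at least `g * s`.
  select : ∀ Y → Unique Y → length Y ≡ M → ∃ λ P → Chain T P × L ≤ length P × P ⊆ Y
  select Y uY lY = from-ih (ih Y uY (subst (_< N) (sym lY) M<N))
    where
    from-ih : (∃ λ P → Chain T P × P ⊆ Y × length Y ≤ length P ^ q) → ∃ λ P → Chain T P × L ≤ length P × P ⊆ Y
    from-ih (P , ch , P⊆ , Y≤) = P , ch , ℕₚ.*-cancelˡ-≤ 2 (ℕₚ.≤-trans 2gs≤t (ℕₚ.<⇒≤ (ℕₚ.≰⇒>
      (half-bound {q} {t} {N} {suc σ} t^q<N {length P} {M} R≤2^q (ℕₚ.≤-trans (ℕₚ.≤-trans N≤2DM (ℕₚ.≤-reflexive (sym (ℕₚ.*-assoc 2 D M)))) (ℕₚ.*-monoˡ-≤ M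
        (ℕₚ.≤-trans (ℕₚ.≤-trans (ℕₚ.m≤m+n (2 * D) _) (ℕₚ.m≤n+m _ (D * suc k₂))) σ≥)))
        (subst (_≤ length P ^ q) lY Y≤))))) , P⊆

  open Sparse (E T) using (Block; IsBlock; Before)

  sequence : Σ (List Block) λ bs → length bs ≡ ℓ × Allᴸ (IsBlock M L V) bs × AllPairs (Before (suc (suc κ))) bs
  sequence = Sparse.Blocks.block-sequence (E T) {e = E H₀} (λ x resp → free i₀ (respects⇒Contains T {H₀} x resp))
    1≤M select ℓ V (s≤s z≤n) (Uniqueₚ.allFin⁺ N)
    (subst (blockFactor (size H₀) (suc (suc κ)) ℓ * M ≤_) (sym |V|)
      (ℕₚ.≤-trans (ℕₚ.*-monoˡ-≤ M (ℕₚ.≤-trans (ℕₚ.m≤n+m _ 2) D≥)) DM≤N))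

  -- The number λ₀ of the strong EH-property is allowed to depend on c₁, whereas the blocks have size
  -- at least c|T| with c depending on λ₀.  Hence the property is applied to the subtournament on
  -- the union of the blocks, of which every block is a fixed fraction whatever λ₀ is.
  module Union {X : List (Fin N)} (uX : Unique X) (|X| : length X ≡ ℓ * (2 * M)) where

    T′ = induced T X uX
    f = lookup X

    N′≤N : length X ≤ N
    N′≤N = subst (_≤ N) (∣fromList∣ uX) (Subsetₚ.∣p∣≤n (fromList X))

    N≤DN′ : N ≤ D * length X
    N≤DN′ = ℕₚ.≤-trans N≤2DM (ℕₚ.≤-trans
      (ℕₚ.≤-reflexive (trans (sym (ℕₚ.*-assoc 2 D M)) (trans (cong (_* M) (ℕₚ.*-comm 2 D)) (ℕₚ.*-assoc D 2 M))))
      (ℕₚ.*-monoʳ-≤ D (subst (2 * M ≤_) (sym |X|) (subst (_≤ ℓ * (2 * M)) (ℕₚ.*-identityˡ (2 * M)) (ℕₚ.*-monoˡ-≤ (2 * M) 1≤ℓ)))))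

    image : Subset (length X) → List (Fin N)
    image A = map f (elems A)

    image-unique : ∀ A → Unique (image A)
    image-unique A = Uniqueₚ.map⁺ (lookup-injective uX _ _) (elems-unique A)

    |image| : ∀ A → length (image A) ≡ ∣ A ∣
    |image| A = trans (Listₚ.length-map f (elems A)) (length-elems A)

    N≤R∣A∣ : ∀ (A : Subset (length X)) → length X ≤ suc k₂ * ∣ A ∣ → N ≤ suc σ * ∣ A ∣
    N≤R∣A∣ A h = ℕₚ.≤-trans N≤DN′ (ℕₚ.≤-trans (ℕₚ.*-monoʳ-≤ D h)
      (ℕₚ.≤-trans (ℕₚ.≤-reflexive (sym (ℕₚ.*-assoc D (suc k₂) ∣ A ∣)))
        (ℕₚ.*-monoˡ-≤ ∣ A ∣ (ℕₚ.≤-trans (ℕₚ.m≤m+n (D * suc k₂) _) σ≥))))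

    -- The union of the blocks may be as large as `T`; a vertex of `B` missing from `A` is what
    -- makes the induction hypothesis available for `A`.
    proper : ∀ {A B} → Disjoint A B → Subset.Nonempty B → length (image A) < N
    proper {A} {B} dis (y , y∈) = subst (_< N) (sym (|image| A)) (ℕₚ.<-≤-trans
      (subst (∣ A ∣ <_) (Subsetₚ.∣⊤∣≡n (length X)) (Subsetₚ.p⊂q⇒∣p∣<∣q∣
        (Subsetₚ.⊆-max A , y , Subsetₚ.∈⊤ , λ y∈A → dis (y , Subsetₚ.x∈p∩q⁺ (y∈A , y∈))))) N′≤N)

    ChainIn : Subset (length X) → ℕ → Set
    ChainIn A n = ∃ λ P → Chain T P × P ⊆ image A × n ≡ length P

    join : ∀ {A B a b} → CompleteTo T′ A B → ChainIn A a → ChainIn B b → a + b ≤ t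
    join {A} {B} complete (P , chP , P⊆ , refl) (Q , chQ , Q⊆ , refl) =
      subst (_≤ t) (Listₚ.length-++ P) (chain-≤ T isTr (AllPairsₚ.++⁺ chP chQ
        (Allᴸ.tabulate λ x∈ → Allᴸ.tabulate λ y∈ → edge (P⊆ x∈) (Q⊆ y∈))))
      where
      edge : ∀ {x y} → x ∈ image A → y ∈ image B → E T x y ≡ true
      edge x∈ y∈ with ∈ₚ.∈-map⁻ f x∈ | ∈ₚ.∈-map⁻ f y∈
      ... | a , a∈ , refl | b , b∈ , refl = complete a b (∈-elems⁻ A a∈) (∈-elems⁻ B b∈)

    by-ih : ∀ {A B} → Disjoint A B → Subset.Nonempty B → ∃ λ a → ChainIn A a × ∣ A ∣ ≤ a ^ q
    by-ih {A} dis ne with ih (image A) (image-unique A) (proper dis ne)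
    ... | P , ch , P⊆ , h = length P , (P , ch , P⊆ , refl) , subst (_≤ length P ^ q) (|image| A) h

    by-transitivity : ∀ {B} → TransitiveSet T′ B → ChainIn B ∣ B ∣
    by-transitivity {B} tr with transitive⇒chain T′ tr
    ... | P , ch , len , P⊆ = map f P , AllPairsₚ.map⁺ ch , sub , trans (sym len) (sym (Listₚ.length-map f P))
      where
      sub : map f P ⊆ image B
      sub x∈ with ∈ₚ.∈-map⁻ f x∈
      ... | y , y∈ , refl = ∈ₚ.∈-map⁺ f (∈-fromList⁻ (subst (y Subset.∈_) (sym (fromList-elems B)) (P⊆ y∈)))

    strong-pair-absurd : ∀ {t′ A B} → t ≤ 4 * t′ → Disjoint A B → Subset.Nonempty A → Subset.Nonempty B →
      CompleteTo T′ A B ⊎ CompleteTo T′ B A → length X ≤ suc k₂ * ∣ A ∣ →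
      (length X ≤ suc k₂ * ∣ B ∣) ⊎ (TransitiveSet T′ B × t′ ≤ suc k₂ * ∣ B ∣) → ⊥
    strong-pair-absurd {t′} {A} {B} t≤4t′ dis neA neB complete largeA alternative with by-ih dis neB
    ... | a , chainA , A≤ = finish alternative
      where
      swap : Disjoint B A
      swap = Disjoint-sym {A = A} {B} dis
      together : ∀ {b} → ChainIn B b → a + b ≤ t
      together {b} chainB = by-direction complete
        where
        by-direction : CompleteTo T′ A B ⊎ CompleteTo T′ B A → a + b ≤ t
        by-direction (inj₁ AB) = join AB chainA chainB
        by-direction (inj₂ BA) = subst (_≤ t) (ℕₚ.+-comm b a) (join BA chainB chainA)
      finish : (length X ≤ suc k₂ * ∣ B ∣) ⊎ (TransitiveSet T′ B × t′ ≤ suc k₂ * ∣ B ∣) → ⊥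
      finish (inj₁ largeB) with by-ih swap neA
      ... | b , chainB , B≤ = two-sets {q} {t} {N} {suc σ} t^q<N {a} {b} {∣ A ∣} {∣ B ∣} R≤2^q (N≤R∣A∣ A largeA) A≤ (N≤R∣A∣ B largeB) B≤ (together chainB)
      finish (inj₂ (trB , t′≤)) = set-and-transitive {q} {t} {N} {σ} {a} {∣ B ∣} {∣ A ∣} t^q<N 1≤σ σσ≤q (N≤R∣A∣ A largeA) A≤ t≤ (together (by-transitivity trB))
        where
        t≤ : t ≤ suc σ * ∣ B ∣
        t≤ = ℕₚ.≤-trans t≤4t′ (ℕₚ.≤-trans (ℕₚ.*-monoʳ-≤ 4 t′≤)
          (ℕₚ.≤-trans (ℕₚ.≤-reflexive (sym (ℕₚ.*-assoc 4 (suc k₂) ∣ B ∣)))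
            (ℕₚ.*-monoˡ-≤ ∣ B ∣ (ℕₚ.≤-trans (ℕₚ.≤-trans (ℕₚ.m≤n+m _ (2 * D)) (ℕₚ.m≤n+m _ (D * suc k₂))) σ≥))))

    tr′≤t : ∀ {t′} → IsTr T′ t′ → t′ ≤ t
    tr′≤t ((S , tr , size-S) , _) with by-transitivity tr
    ... | P , ch , _ , len = subst (_≤ t) (trans (sym len) size-S) (chain-≤ T isTr ch)

    small : ∀ {n} (η′ : Vec ℕ n) → Vec.sum η′ ≤ g → All (λ p → p * s ≤ L) η′
    small [] _ = []
    small (p ∷ η′) h = ℕₚ.*-monoˡ-≤ s (ℕₚ.≤-trans (ℕₚ.m≤m+n p _) h) ∷ small η′ (ℕₚ.≤-trans (ℕₚ.m≤n+m _ p) h)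

    open Sparse (E T′) using () renaming (IsBlock to IsBlock′; Before to Before′)

    module _ {t′ : ℕ} (isTr′ : IsTr T′ t′) (L≤t′ : L ≤ t′) where

      -- A chain of length `L` lies inside the union, so passing to the union lowers `tr` by at most
      -- a factor 4. The transitive part of a strong pair, measured by `tr(T′)`, thus remains
      -- comparable with `tr(T)`.
      t≤4t′ : t ≤ 4 * t′
      t≤4t′ = ℕₚ.≤-trans t≤4gs (ℕₚ.*-monoʳ-≤ 4 L≤t′)

      sizes : ∀ {B} → (c₂ ℚ.* ℕ→ℚ (length X) ℚ.≤ ℕ→ℚ ∣ B ∣) ⊎ (TransitiveSet T′ B × (c₂ ℚ.* ℕ→ℚ t′ ℚ.≤ ℕ→ℚ ∣ B ∣)) →
        (length X ≤ suc k₂ * ∣ B ∣) ⊎ (TransitiveSet T′ B × t′ ≤ suc k₂ * ∣ B ∣)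
      sizes (inj₁ h) = inj₁ (≤⇒≤-unit k₂ c₂≥ h)
      sizes (inj₂ (tr , h)) = inj₂ (tr , ≤⇒≤-unit k₂ c₂≥ h)

      outcome-absurd : ∀ {χ : Seq (length X) v η} → (∃ λ i → Contains T′ (Hs i)) ⊎ StrongPair T′ t′ c₂ χ → ⊥
      outcome-absurd (inj₁ (i , c)) = free i (induced-Contains T {Hs i} X uX c)
      outcome-absurd (inj₂ (A , B , dis , _ , _ , largeA , alternative , inj₁ d@(neA , neB , _))) =
        strong-pair-absurd {t′} {A} {B} t≤4t′ dis neA neB (inj₁ (densityOne⇒complete T′ dis d))
          (≤⇒≤-unit k₂ c₂≥ largeA) (sizes alternative)
      outcome-absurd (inj₂ (A , B , dis , _ , _ , largeA , alternative , inj₂ d@(neB , neA , _))) =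
        strong-pair-absurd {t′} {A} {B} t≤4t′ dis neA neB (inj₂ (densityOne⇒complete T′ (Disjoint-sym {A = A} {B} dis) d))
          (≤⇒≤-unit k₂ c₂≥ largeA) (sizes alternative)

      N′≤k₁ : length X ≤ suc k₁ * (2 * M)
      N′≤k₁ = subst (_≤ suc k₁ * (2 * M)) (sym |X|) (ℕₚ.*-monoˡ-≤ (2 * M) (ℕₚ.≤-trans (ℕₚ.m≤m+n ℓ (4 * g)) k₁≥))

      t′≤k₁ : t′ ≤ suc k₁ * s
      t′≤k₁ = ℕₚ.≤-trans (tr′≤t isTr′) (ℕₚ.≤-trans t≤4gs (ℕₚ.≤-trans (ℕₚ.≤-reflexive (sym (ℕₚ.*-assoc 4 g s)))
        (ℕₚ.*-monoˡ-≤ s (ℕₚ.≤-trans (ℕₚ.m≤n+m (4 * g) ℓ) k₁≥))))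

      blocks-absurd : ∀ bs → length bs ≡ ℓ → Allᴸ (IsBlock′ M L (allFin (length X))) bs →
        AllPairs (Before′ (suc (suc κ))) bs → ⊥
      blocks-absurd bs len oks befores = outcome-absurd {χ} (seh T′ t′ isTr′ χ
        (mkSeq-isMSeq T′ {t′} {k₁} {κ} {M} {L} {s} v η bs v≤bs 1≤M 1≤L N′≤k₁ t′≤k₁ pos (small η (ℕₚ.<⇒≤ η<g)) oks befores))
        where
        v≤bs : length v ≤ length bs
        v≤bs = ℕₚ.≤-trans (ℕₚ.<⇒≤ v<ℓ) (ℕₚ.≤-reflexive (sym len))
        χ : Seq (length X) v η
        χ = MSequence.mkSeq T′ s v η bs v≤bs

    absurd-from : ∀ bs → length bs ≡ ℓ → Allᴸ (IsBlock′ M L (allFin (length X))) bs →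
      AllPairs (Before′ (suc (suc κ))) bs → ⊥
    absurd-from [] len _ _ = contradiction (subst (1 ≤_) (sym len) 1≤ℓ) λ ()
    absurd-from ((B , P) ∷ bs) len (ok@(_ , _ , _ , chP , L≤P , _) ∷ oks) befores = from-tr (tr-exists T′)
      where
      from-tr : (∃ λ t′ → IsTr T′ t′) → ⊥
      from-tr (t′ , isTr′) = blocks-absurd isTr′ (ℕₚ.≤-trans L≤P (chain-≤ T′ isTr′ chP)) ((B , P) ∷ bs) len (ok ∷ oks) befores

  contradictory : ⊥
  contradictory = from-sequence sequence
    where
    from-restriction : Restriction T (suc (suc κ)) ℓ M L → ⊥
    from-restriction (restriction uX |X| bs len oks befores) = Union.absurd-from uX |X| bs len oks befores
    from-sequence : (Σ (List Block) λ bs → length bs ≡ ℓ × Allᴸ (IsBlock M L V) bs × AllPairs (Before (suc (suc κ))) bs) → ⊥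
    from-sequence (bs , len , oks , befores) = from-restriction
      (subst (λ k → Restriction T (suc (suc κ)) k M L) len (restrict T {M} {L} {V} {suc (suc κ)} bs oks befores))

-- Choice of the constants and induction on the size

module Bound
  {m : ℕ} (Hs : Fin m → Tournament) (i₀ : Fin m) (v : List Bool) (η : Vec ℕ (ones v))
  (pos : All (1 ≤_) η) (Fs : (i : Fin m) → Fin (size (Hs i)) → Fin (kOf v η))
  (strong : StrongEH Hs v η Fs) where

  -- This makes `suc k₁ = ℓ + 4 g`: a block is a `1/ℓ` fraction of the union, and a part has at
  -- least `tr / (4 g)` vertices. Neither involves `λ₀`, so the strong property can be invoked
  -- before any block is built.
  k₁ = length v + 4 * suc (Vec.sum η)
  λ₀,c₂ = strong (unit k₁) (unit>0 k₁)
  λ₀ = proj₁ λ₀,c₂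
  c₂ = proj₁ (proj₂ λ₀,c₂)

  below-λ₀ = unit-below λ₀ (proj₁ (proj₂ (proj₂ λ₀,c₂)))
  below-c₂ = unit-below c₂ (proj₁ (proj₂ (proj₂ (proj₂ λ₀,c₂))))
  κ = proj₁ below-λ₀
  k₂ = proj₁ below-c₂

  strong′ : ∀ T t → IsTr T t → ∀ (χ : Seq (size T) v η) → IsMSeq T t (unit k₁) (unit (suc κ)) χ →
    (∃ λ i → Contains T (Hs i)) ⊎ StrongPair T t c₂ χ
  strong′ T t isTr χ isMSeq
    with proj₂ (proj₂ (proj₂ (proj₂ λ₀,c₂))) T t isTr (unit (suc κ)) (ℚₚ.<⇒≤ (unit>0 (suc κ)))
           (proj₂ below-λ₀ (suc κ) (ℕₚ.n≤1+n κ)) χ isMSeq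
  ... | inj₁ (i , x , _ , emb) = inj₁ (i , x , emb)
  ... | inj₂ pair = inj₂ pair

  opaque
    -- The 2 in `D` makes `M` smaller than the tournament. In `σ`, the summand `D * suc k₂` serves
    -- the linear-sized sets of a strong pair, `2 * D` the sets of size `M` in `select`, and
    -- `4 * suc k₂` the transitive set of a strong pair. In `q`, the square is for `power-gap`, and
    -- the rest raises `2 ^ q` above `suc σ` and `N₀`.
    D σ N₀ q : ℕ
    D = 2 + blockFactor (size (Hs i₀)) (suc (suc κ)) (suc (length v))
    σ = suc (D * suc k₂ + (2 * D + 4 * suc k₂))
    N₀ = D + 2 ^ (2 * suc (Vec.sum η))
    q = σ * σ + (suc σ + N₀)

    D-large : 2 + blockFactor (size (Hs i₀)) (suc (suc κ)) (suc (length v)) ≤ D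
    D-large = ℕₚ.≤-refl

    σ-large : D * suc k₂ + (2 * D + 4 * suc k₂) ≤ suc σ
    σ-large = ℕₚ.≤-trans (ℕₚ.n≤1+n _) (ℕₚ.n≤1+n _)

    1≤σ : 1 ≤ σ
    1≤σ = s≤s z≤n

    σσ≤q : σ * σ ≤ q
    σσ≤q = ℕₚ.m≤m+n _ _

    q-nonZero : NonZero q
    q-nonZero = >-nonZero (ℕₚ.≤-trans 1≤σ (ℕₚ.≤-trans (ℕₚ.m≤m+n σ _) σσ≤q))

    R≤2^q : suc σ ≤ 2 ^ q
    R≤2^q = ℕₚ.≤-trans (ℕₚ.≤-trans (ℕₚ.m≤m+n (suc σ) N₀) (ℕₚ.m≤n+m _ (σ * σ))) (ℕₚ.<⇒≤ (n<2^n q))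

    N₀≤2^q : D + 2 ^ (2 * suc (Vec.sum η)) ≤ 2 ^ q
    N₀≤2^q = ℕₚ.≤-trans (ℕₚ.≤-trans (ℕₚ.m≤n+m N₀ (suc σ)) (ℕₚ.m≤n+m _ (σ * σ))) (ℕₚ.<⇒≤ (n<2^n q))

  -- Well-founded induction on the size stands in for a minimal counterexample; comparing `size T`
  -- with `t ^ q` is decidable once `tr(T)` has been found.
  large-chain : ∀ T → Acc _<_ (size T) → (∀ i → ¬ Contains T (Hs i)) → ∃ λ P → Chain T P × size T ≤ length P ^ q
  large-chain T (acc smaller) free = from-tr (tr-exists T)
    where
    ih : ∀ Y → Unique Y → length Y < size T → ∃ λ P → Chain T P × P ⊆ Y × length Y ≤ length P ^ q
    ih Y uY lt = lift-chain (large-chain (induced T Y uY) (smaller lt) (λ i c → free i (induced-Contains T {Hs i} Y uY c)))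
      where
      lift-chain : (∃ λ P → Chain (induced T Y uY) P × length Y ≤ length P ^ q) →
        ∃ λ P → Chain T P × P ⊆ Y × length Y ≤ length P ^ q
      lift-chain (P , ch , h) = map (lookup Y) P , AllPairsₚ.map⁺ ch , inside ,
        subst (λ n → length Y ≤ n ^ q) (sym (Listₚ.length-map (lookup Y) P)) h
        where
        inside : map (lookup Y) P ⊆ Y
        inside x∈ with ∈ₚ.∈-map⁻ (lookup Y) x∈
        ... | i , _ , refl = ∈ₚ.∈-lookup i
    from-tr : (∃ λ t → IsTr T t) → ∃ λ P → Chain T P × size T ≤ length P ^ q
    from-tr (t , isTr@((S , tr , size-S) , _)) = compare (transitive⇒chain T tr) (size T ≤? t ^ q)
      where
      compare : (∃ λ xs → Chain T xs × length xs ≡ ∣ S ∣ × (∀ {z} → z ∈ xs → z Subset.∈ S)) → Dec (size T ≤ t ^ q) →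
        ∃ λ P → Chain T P × size T ≤ length P ^ q
      compare (P , ch , len , _) (yes N≤) = P , ch , subst (λ n → size T ≤ n ^ q) (sym (trans len size-S)) N≤
      compare _ (no N≰) = ⊥-elim (Step.contradictory Hs i₀ v η pos (suc (length v)) (suc (Vec.sum η)) k₁ κ k₂ D σ q c₂ ℕₚ.≤-refl ℕₚ.≤-refl ℕₚ.≤-refl
        (proj₂ below-c₂ k₂ ℕₚ.≤-refl) D-large σ-large 1≤σ σσ≤q R≤2^q N₀≤2^q strong′ T free ih isTr (ℕₚ.≰⇒> N≰))

  eh : EHProperty Hs
  eh = 1 , q , _ , q-nonZero , λ T free → from-chain T (large-chain T (<-wellFounded (size T)) free)
    where
    from-chain : ∀ T → (∃ λ P → Chain T P × size T ≤ length P ^ q) →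
      Σ (Subset (size T)) λ S → TransitiveSet T S × AtLeastPow ∣ S ∣ (size T) 1 q
    from-chain T (P , ch , h) = fromList P , chain⇒transitive T ch ,
      subst₂ (λ a b → a ≤ b ^ q) (sym (ℕₚ.^-identityʳ (size T))) (sym (∣fromList∣ (Chain⇒Unique T ch))) h

theorem7 : (m : ℕ) → 1 ≤ m → (Hs : Fin m → Tournament) → (H : Tournament)
    → (∀ i → Contains (Hs i) H)
    → (v : List Bool) → (η : Vec ℕ (ones v)) → All (λ a → 1 ≤ a) η
    → (Fs : (i : Fin m) → Fin (size (Hs i)) → Fin (kOf v η))
    → (∀ i → Injective _≡_ _≡_ (Fs i))
    → StrongEH Hs v η Fs
    → EHProperty Hs × ErdosHajnal H
theorem7 (suc m) _ Hs H Hs⊇H v η pos Fs _ strong = eh , erdős-hajnal eh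
  where
  eh = Bound.eh Hs zero v η pos Fs strong
  erdős-hajnal : EHProperty Hs → ErdosHajnal H
  erdős-hajnal (p , q , p≢0 , q≢0 , transitive) =
    p , q , p≢0 , q≢0 , λ T ¬H → transitive T λ i c → ¬H (Contains-trans {T} {Hs i} {H} c (Hs⊇H i))
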